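{- Let $R$ be any totally ordered semi-ring and let $q\geq 2$ be an integer. There is a constant $\epsilon>0$ such that for all sufficiently large $n$, if the cut polynomial $\mathrm{Cut}^q_n$ is a monotone affine projection of the permanent $\mathrm{perm}_m$ over $R$, then $m\geq 2^{\epsilon n}$. In particular, the family $(\mathrm{Cut}^q_n)_n$ is not a monotone affine p-projection of the family $(\mathrm{perm}_m)$.
   Context: A (commutative) totally ordered semi-ring is a totally ordered set $(R,\leq)$ with operations $\times,+$ and elements $1\neq 0$ such that $(R,\times,1)$, $(R,+,0)$ are commutative monoids, $\times$ distributes over $+$, $0\times a=0$, $a+c\leq b+c$ whenever $a\leq b$, and $ac\leq bc$ whenever $a\leq b$ and $0\leq c$. An element $c$ is non-negative if $0\leq c$. Polynomials are formal polynomials over $R$. The permanent is $\mathrm{perm}_m(Y)=\sum_{\pi\in S_m} y_{1,\pi(1)}\cdots y_{m,\pi(m)}$ in the $m^2$ variables $y_{ij}$. The $q$-th cut polynomial in variables $x_{ij}$ ($i,j\in[n]$, $i\neq j$) is $\mathrm{Cut}^q_n=\sum_{A\subseteq[n]}\prod_{i\in A,\, j\notin A} x_{ij}^{q-1}$. A polynomial $f(x_1,\dots,x_N)$ is a monotone affine projection of $g(y_1,\dots,y_M)$ if $f$ is obtained from $g$ by substituting for each $y_i$ an affine linear function $a_0+a_1x_1+\dots+a_Nx_N$ with all $a_k\in R$ non-negative. A family $(f_n)$ is a monotone affine p-projection of $(g_m)$ if there is a polynomially bounded $p$ with $f_n$ a monotone affine projection of $g_{p(n)}$ for all sufficiently large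 $n$. -}

module Defs where

open import Level using (Level) renaming (suc to lsuc)
open import Data.Nat as ℕ using (ℕ; zero; suc; _∸_)
open import Data.Bool using (Bool; true; false; if_then_else_; _∧_; not)
open import Data.Fin using (Fin)
open import Data.Fin.Properties using () renaming (_≟_ to _≟F_)
open import Data.List using (List; []; _∷_; _++_; map; foldr; concatMap; filter; allFin)
open import Data.Bool.ListAction using (and)
open import Data.List.Membership.Propositional using (_∈_)
open import Data.Vec using (Vec; []; _∷_; lookup; toList)
open import Data.Product using (Σ; _×_; _,_; proj₁; proj₂)
open import Relation.Binary.PropositionalEquality using (_≡_; _≢_)
open import Relation.Binary.Definitions using (DecidableEquality)
open import Relation.Nullary.Decidable using (⌊_⌋; ¬?)
open import Algebra.Structures using (IsCommutativeSemiring)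
open import Relation.Binary.Structures using (IsTotalOrder)
import Data.Product.Properties as ×P
import Data.List.Relation.Unary.Unique.DecPropositional as UniqueDec

record TOSemiring (ℓ : Level) : Set (lsuc ℓ) where
  infixl 6 _+_
  infixl 7 _*_
  infix  4 _≤_
  field
    Carrier : Set ℓ
    _+_ _*_ : Carrier → Carrier → Carrier
    0# 1#   : Carrier
    _≤_     : Carrier → Carrier → Set ℓ
    isCommutativeSemiring : IsCommutativeSemiring _≡_ _+_ _*_ 0# 1#
    isTotalOrder : IsTotalOrder _≡_ _≤_
    1≢0    : 1# ≢ 0#
    +-mono : ∀ {a b} c → a ≤ b → a + c ≤ b + c
    *-mono : ∀ {a b c} → a ≤ b → 0# ≤ c → a * c ≤ b * c

-- Formal polynomials over R in variables of type V.
-- A polynomial is a finite list of terms (coefficient, monomial), where a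
-- monomial is an exponent function V → ℕ.  It denotes the formal sum of its
-- terms.  The variables actually in play are given by a list `vs` (the
-- variable set); polynomials are compared coefficient-wise, the coefficient
-- of a monomial being the sum of the coefficients of all terms whose
-- exponents agree with it on every variable of `vs`.

module Poly {ℓ : Level} (R : TOSemiring ℓ) where
  open TOSemiring R

  Monomial : Set → Set
  Monomial V = V → ℕ

  Poly : Set → Set ℓ
  Poly V = List (Carrier × Monomial V)

  module _ {V : Set} where

    unitM : Monomial V
    unitM _ = 0

    constP : Carrier → Poly V
    constP c = (c , unitM) ∷ []

    varP : DecidableEquality V → V → Poly V
    varP _≟_ v = (1# , λ w → if ⌊ w ≟ v ⌋ then 1 else 0) ∷ []

    _+P_ : Poly V → Poly V → Poly V
    p +P q = p ++ q

    _*P_ : Poly V → Poly V → Poly V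
    p *P q = concatMap (λ t → map (λ s → (proj₁ t * proj₁ s , λ v → proj₂ t v ℕ.+ proj₂ s v)) q) p

    scaleP : Carrier → Poly V → Poly V
    scaleP c p = map (λ t → (c * proj₁ t , proj₂ t)) p

    sumP : List (Poly V) → Poly V
    sumP = foldr _+P_ []

    prodP : List (Poly V) → Poly V
    prodP = foldr _*P_ (constP 1#)

    powP : Poly V → ℕ → Poly V
    powP p zero    = constP 1#
    powP p (suc k) = p *P powP p k

    eqMon : List V → Monomial V → Monomial V → Bool
    eqMon vs μ ν = and (map (λ v → ⌊ μ v ℕ.≟ ν v ⌋) vs)

    coeff : List V → Poly V → Monomial V → Carrier
    coeff vs p μ = foldr (λ t acc → if eqMon vs (proj₂ t) μ then proj₁ t + acc else acc) 0# p

    PolyEq : List V → Poly V → Poly V → Set ℓ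
    PolyEq vs p q = ∀ (μ : Monomial V) → coeff vs p μ ≡ coeff vs q μ

  subst : {W V : Set} → List W → Poly W → (W → Poly V) → Poly V
  subst ws g L = sumP (map (λ t → scaleP (proj₁ t) (prodP (map (λ w → powP (L w) (proj₂ t w)) ws))) g)

  affine : {V : Set} → DecidableEquality V → List V → Carrier → (V → Carrier) → Poly V
  affine _≟_ vs a₀ a = constP a₀ +P sumP (map (λ v → scaleP (a v) (varP _≟_ v)) vs)

  MonAffProj : {V W : Set} → DecidableEquality V → List V → Poly V → List W → Poly W → Set ℓ
  MonAffProj {V} {W} _≟_ vs f ws g =
    Σ (W → Carrier) λ a₀ → Σ (W → V → Carrier) λ a →
      (∀ w → 0# ≤ a₀ w) × (∀ w v → v ∈ vs → 0# ≤ a w v) ×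
      PolyEq vs f (subst ws g (λ w → affine _≟_ vs (a₀ w) (a w)))

pairs : (n : ℕ) → List (Fin n × Fin n)
pairs n = concatMap (λ i → map (λ j → (i , j)) (allFin n)) (allFin n)

_≟P_ : ∀ {n} → DecidableEquality (Fin n × Fin n)
_≟P_ = ×P.≡-dec _≟F_ _≟F_

-- off-diagonal pairs (i , j), i ≢ j : the variables x_ij of Cut^q_n
offDiag : (n : ℕ) → List (Fin n × Fin n)
offDiag n = filter (λ ij → ¬? (proj₁ ij ≟F proj₂ ij)) (pairs n)

allVecs : (k n : ℕ) → List (Vec (Fin n) k)
allVecs zero    n = [] ∷ []
allVecs (suc k) n = concatMap (λ i → map (i ∷_) (allVecs k n)) (allFin n)

-- the symmetric group S_m, as the list of all injective (hence bijective)
-- maps Fin m → Fin m, written as vectors of their values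
permutations : (m : ℕ) → List (Vec (Fin m) m)
permutations m = filter (λ σ → UniqueDec.unique? _≟F_ (toList σ)) (allVecs m m)

subsets : (n : ℕ) → List (Vec Bool n)
subsets zero    = [] ∷ []
subsets (suc n) = concatMap (λ b → map (b ∷_) (subsets n)) (true ∷ false ∷ [])

module Objects {ℓ : Level} (R : TOSemiring ℓ) where
  open TOSemiring R
  open Poly R

  perm : (m : ℕ) → Poly (Fin m × Fin m)
  perm m = sumP (map (λ σ → prodP (map (λ i → varP _≟P_ (i , lookup σ i)) (allFin m))) (permutations m))

  cutMon : (q n : ℕ) → Vec Bool n → Monomial (Fin n × Fin n)
  cutMon q n A ij = if lookup A (proj₁ ij) ∧ not (lookup A (proj₂ ij)) then q ∸ 1 else 0

  Cut : (q n : ℕ) → Poly (Fin n × Fin n)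
  Cut q n = map (λ A → (1# , cutMon q n A)) (subsets n)

  CutProjPerm : (q n m : ℕ) → Set ℓ
  CutProjPerm q n m = MonAffProj _≟P_ (offDiag n) (Cut q n) (pairs m) (perm m)

PolyBounded : (ℕ → ℕ) → Set
PolyBounded p = Σ ℕ λ c → Σ ℕ λ k → ∀ n → p n ℕ.≤ c ℕ.* n ℕ.^ k ℕ.+ c

{-# OPTIONS --safe #-}
module Submission where

-- A projection writes every cut as a labelled perfect matching of K_{m,m}: a permutation σ
-- together with, for each i, a constant or variable occurring in the form substituted for
-- y_{i,σ(i)}; conversely every such labelled matching yields a cut.  Each set b of vertices
-- gives a facet inequality of the cut polytope whose slack at the cut a is (1 - |a ∩ b|)².
-- If each labelled edge of the matching of a lies on a matching that is tight for b, then the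
-- union of these m matchings minus that of a is an (m - 1)-regular bipartite multigraph;
-- by Hall's theorem it splits into m - 1 matchings, all satisfying the inequality, so a is tight
-- as well.  Hence, when a ∩ b = ∅, some labelled edge of a lies on no matching tight for b.
-- The labelled edges therefore define polynomially many (in m and n) rectangles that cover all
-- disjoint pairs (a , b) and avoid |a ∩ b| = 1.  By Kaibel and Weltge each of them
-- contains at most 2ⁿ of the 3ⁿ disjoint pairs.

open import Defs
open import Algebra.Structures using (IsCommutativeSemiring)
open import Data.Bool using (Bool; true; false; _∧_; _∨_; not; if_then_else_)
open import Data.Empty using (⊥; ⊥-elim)
open import Data.Fin using (Fin; zero; suc)
open import Data.Fin.Properties using (_≟_; any?) renaming (suc-injective to suc-injectiveᶠ)
open import Data.List using (List; []; _∷_; _++_; map; concatMap; allFin; tabulate; cartesianProduct)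
open import Data.List.Membership.Propositional using (_∈_; _∉_; find; lose)
open import Data.List.Membership.Propositional.Properties using (∈-allFin; ∈-filter⁺; ∈-filter⁻; ∈-cartesianProduct⁺; ∈-map⁺; ∈-concatMap⁺)
open import Data.List.Properties using (map-tabulate)
open import Data.List.Relation.Unary.All as All using (All; []; _∷_)
import Data.List.Relation.Unary.All.Properties as All
open import Data.List.Relation.Unary.AllPairs using (_∷_)
open import Data.List.Relation.Unary.Any as Any using (Any; here; there)
import Data.List.Relation.Unary.Any.Properties as Any
import Data.List.Relation.Unary.Unique.DecPropositional as UniqueDec
open import Data.List.Relation.Unary.Unique.Propositional using (Unique)
import Data.List.Relation.Unary.Unique.Propositional.Properties as Unique
open import Data.Nat as ℕ using (ℕ; zero; suc; z≤n; s≤s)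
import Data.Nat.Properties as ℕ
open import Data.Product using (Σ; _×_; _,_; proj₁; proj₂)
open import Data.Product.Properties using (≡-dec)
open import Data.Sum using (_⊎_; inj₁; inj₂)
open import Data.Unit.Polymorphic using (⊤; tt)
open import Data.Vec as Vec using (Vec; []; _∷_; lookup; toList)
open import Data.Vec.Properties using (lookup∘tabulate)
open import Function using (_∘_; Injective)
open import Level using (Level)
open import Relation.Binary.Definitions using (DecidableEquality)
open import Relation.Binary.PropositionalEquality as Eq hiding (subst)
open import Relation.Binary.Structures using (IsTotalOrder)
open import Relation.Nullary using (¬_; Dec; yes; no; does)
open import Relation.Nullary.Decidable using (⌊_⌋; ¬?; map′; _×-dec_; dec-true; dec-false; decidable-stable; toWitness)
open import Algebra.Properties.CommutativeSemigroup ℕ.+-commutativeSemigroup using (x∙yz≈y∙xz)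
open import Algebra.Properties.Semiring.Sum ℕ.+-*-semiring
  using (sum; sum-cong-≗; ∑-distrib-+; ∑-comm; *-distribˡ-sum; *-distribʳ-sum; sum-syntax)

-- Index sets

pairs≡cartesianProduct : ∀ n → pairs n ≡ cartesianProduct (allFin n) (allFin n)
pairs≡cartesianProduct n = go (allFin n)
  where
  go : ∀ is → concatMap (λ i → map (i ,_) (allFin n)) is ≡ cartesianProduct is (allFin n)
  go []       = refl
  go (i ∷ is) = cong (map (i ,_) (allFin n) ++_) (go is)

pairs-complete : ∀ {n} (ij : Fin n × Fin n) → ij ∈ pairs n
pairs-complete {n} (i , j) rewrite pairs≡cartesianProduct n = ∈-cartesianProduct⁺ (∈-allFin i) (∈-allFin j)

pairs-unique : ∀ n → Unique (pairs n)
pairs-unique n rewrite pairs≡cartesianProduct n = Unique.cartesianProduct⁺ (Unique.allFin⁺ n) (Unique.allFin⁺ n)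

offDiag-complete : ∀ {n} {i j : Fin n} → i ≢ j → (i , j) ∈ offDiag n
offDiag-complete {n} {i} {j} i≢j =
  ∈-filter⁺ (λ ij → ¬? (proj₁ ij ≟ proj₂ ij)) (pairs-complete (i , j)) i≢j

subsets-complete : ∀ {n} (A : Vec Bool n) → A ∈ subsets n
subsets-complete []          = here refl
subsets-complete (true ∷ A)  = Any.++⁺ˡ (∈-map⁺ (true ∷_) (subsets-complete A))
subsets-complete (false ∷ A) = Any.++⁺ʳ (map (true ∷_) (subsets _))
  (Any.++⁺ˡ (∈-map⁺ (false ∷_) (subsets-complete A)))

allVecs-complete : ∀ {k n} (v : Vec (Fin n) k) → v ∈ allVecs k n
allVecs-complete []      = here refl
allVecs-complete (i ∷ v) = ∈-concatMap⁺ _ (lose (∈-allFin i) (∈-map⁺ (i ∷_) (allVecs-complete v)))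

toList-tabulate : ∀ {A : Set} {k} (f : Fin k → A) → toList (Vec.tabulate f) ≡ tabulate f
toList-tabulate {k = zero}  f = refl
toList-tabulate {k = suc k} f = cong (f zero ∷_) (toList-tabulate (f ∘ suc))

lookup-≢ : ∀ {A : Set} {x : A} {k} (v : Vec A k) → All (x ≢_) (toList v) → ∀ j → x ≢ lookup v j
lookup-≢ (y ∷ v) (ne ∷ _)  zero    = ne
lookup-≢ (y ∷ v) (_ ∷ nes) (suc j) = lookup-≢ v nes j

lookup-injective : ∀ {A : Set} {k} (v : Vec A k) → Unique (toList v) → Injective _≡_ _≡_ (lookup v)
lookup-injective (x ∷ v) u        {zero}  {zero}  _ = refl
lookup-injective (x ∷ v) (x∉ ∷ u) {suc i} {suc j} e = cong suc (lookup-injective v u e)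
lookup-injective (x ∷ v) (x∉ ∷ u) {zero}  {suc j} e = ⊥-elim (lookup-≢ v x∉ j e)
lookup-injective (x ∷ v) (x∉ ∷ u) {suc i} {zero}  e = ⊥-elim (lookup-≢ v x∉ i (sym e))

permutations-sound : ∀ {m} {σ : Vec (Fin m) m} → σ ∈ permutations m → Injective _≡_ _≡_ (lookup σ)
permutations-sound {m} {σ} σ∈ = lookup-injective σ
  (proj₂ (∈-filter⁻ (λ σ → UniqueDec.unique? _≟_ (toList σ)) {xs = allVecs m m} σ∈))

permutations-complete : ∀ {m} (τ : Fin m → Fin m) → Injective _≡_ _≡_ τ → Vec.tabulate τ ∈ permutations m
permutations-complete τ inj = ∈-filter⁺ (λ σ → UniqueDec.unique? _≟_ (toList σ)) (allVecs-complete _)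
  (Eq.subst Unique (sym (toList-tabulate τ)) (Unique.tabulate⁺ inj))

-- Properties of single terms, and comparison of monomials

module Terms {ℓ : Level} (R : TOSemiring ℓ) where
  open TOSemiring R
  open Poly R

  -- `T` stands for a property of terms that survives multiplication. It is used for non-negative
  -- coefficients and, in the case 1 ≤ 0, for terms that cannot contribute to a chosen coefficient.
  module _ {p} {V W : Set} (T : Carrier × Monomial V → Set p)
    (T-1 : T (1# , unitM))
    (T-* : ∀ {t s} → T t → T s → T (proj₁ t * proj₁ s , λ v → proj₂ t v ℕ.+ proj₂ s v)) where

    All-*P : ∀ {p q} → All T p → All T q → All T (p *P q)
    All-*P []         Tq = []
    All-*P (Tt ∷ Tp) Tq = All.++⁺ (All.map⁺ (All.map (T-* Tt) Tq)) (All-*P Tp Tq)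

    All-prodP : ∀ {ps} → All (All T) ps → All T (prodP ps)
    All-prodP []         = T-1 ∷ []
    All-prodP (Tp ∷ Tps) = All-*P Tp (All-prodP Tps)

    All-powP : ∀ {p} k → All T p → All T (powP p k)
    All-powP zero    Tp = T-1 ∷ []
    All-powP (suc k) Tp = All-*P Tp (All-powP k Tp)

    All-subst : ∀ {c} {C : Carrier → Set c} → (∀ {x t} → C x → T t → T (x * proj₁ t , proj₂ t)) →
      ∀ {ws g} {L : W → Poly V} → All (C ∘ proj₁) g → (∀ w → All T (L w)) → All T (subst ws g L)
    All-subst scale []        TL = []
    All-subst scale {ws} {t ∷ g} (Cc ∷ Cg) TL = All.++⁺
      (All.map⁺ (All.map (scale Cc)
        (All-prodP (All.map⁺ (All.universal (λ w → All-powP (proj₂ t w) (TL w)) ws)))))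
      (All-subst scale {ws} Cg TL)

  All-sumP : ∀ {p} {V : Set} {T : Carrier × Monomial V → Set p} {ps} → All (All T) ps → All T (sumP ps)
  All-sumP []         = []
  All-sumP (Tp ∷ Tps) = All.++⁺ Tp (All-sumP Tps)

  All-affine : ∀ {p} {V : Set} {T : Carrier × Monomial V → Set p} (_≟_ : DecidableEquality V) {vs a₀ a} →
    T (a₀ , unitM) → (∀ v → v ∈ vs → T (a v * 1# , λ w → if ⌊ w ≟ v ⌋ then 1 else 0)) →
    All T (affine _≟_ vs a₀ a)
  All-affine {T = T} _≟_ {vs} {a = a} T₀ Tv = T₀ ∷ All-sumP (All.map⁺ (All.tabulate (λ v∈ → Tv _ v∈ ∷ [])))

  -- Exponents count only at the variables in `vs`; for cuts those at diagonal pairs stay arbitrary.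
  _≐[_]_ : {V : Set} → Monomial V → List V → Monomial V → Set
  μ ≐[ vs ] ν = ∀ v → v ∈ vs → μ v ≡ ν v

  module _ {V : Set} where

    eqMon-sound : ∀ vs {μ ν : Monomial V} → eqMon vs μ ν ≡ true → μ ≐[ vs ] ν
    eqMon-sound (u ∷ vs) {μ} {ν} e v v∈ with μ u ℕ.≟ ν u
    eqMon-sound (u ∷ vs) e v (here refl) | yes μ≡ν = μ≡ν
    eqMon-sound (u ∷ vs) e v (there v∈)  | yes μ≡ν = eqMon-sound vs e v v∈

    eqMon-complete : ∀ vs {μ ν : Monomial V} → μ ≐[ vs ] ν → eqMon vs μ ν ≡ true
    eqMon-complete []       μ≐ν = refl
    eqMon-complete (u ∷ vs) {μ} {ν} μ≐ν with μ u ℕ.≟ ν u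
    ... | yes _ = eqMon-complete vs (λ v v∈ → μ≐ν v (there v∈))
    ... | no ne = ⊥-elim (ne (μ≐ν u (here refl)))

-- Supports of polynomials with non-negative coefficients

module Support {ℓ : Level} (R : TOSemiring ℓ) (0≤1 : TOSemiring._≤_ R (TOSemiring.0# R) (TOSemiring.1# R)) where
  open TOSemiring R
  open Poly R
  open Terms R
  private
    module S = IsCommutativeSemiring isCommutativeSemiring
    module O = IsTotalOrder isTotalOrder

  *-monoˡ : ∀ {a b c} → a ≤ b → 0# ≤ c → c * a ≤ c * b
  *-monoˡ {a} {b} {c} a≤b 0≤c = subst₂ _≤_ (S.*-comm a c) (S.*-comm b c) (*-mono a≤b 0≤c)

  0≤+ : ∀ {a b} → 0# ≤ a → 0# ≤ b → 0# ≤ a + b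
  0≤+ {a} {b} 0≤a 0≤b = O.trans 0≤b (subst₂ _≤_ (S.+-identityˡ b) refl (+-mono b 0≤a))

  0≤* : ∀ {a b} → 0# ≤ a → 0# ≤ b → 0# ≤ a * b
  0≤* {a} {b} 0≤a 0≤b = subst₂ _≤_ (S.zeroˡ b) refl (*-mono 0≤a 0≤b)

  a≤a+b : ∀ a {b} → 0# ≤ b → a ≤ a + b
  a≤a+b a {b} 0≤b = subst₂ _≤_ (S.+-identityˡ a) (S.+-comm b a) (+-mono a 0≤b)

  b≤a+b : ∀ {a} b → 0# ≤ a → b ≤ a + b
  b≤a+b b 0≤a = subst₂ _≤_ (S.+-identityˡ b) refl (+-mono b 0≤a)

  -- R may have zero divisors, so being non-zero is not multiplicative; having a multiple above 1
  -- is, and for sums and products of non-negative elements it behaves like being non-zero.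
  Large : Carrier → Set ℓ
  Large a = 0# ≤ a × Σ Carrier λ c → 0# ≤ c × 1# ≤ c * a

  large-1 : Large 1#
  large-1 = 0≤1 , 1# , 0≤1 , O.reflexive (sym (S.*-identityˡ 1#))

  ¬large-0 : ¬ Large 0#
  ¬large-0 (_ , c , _ , 1≤c0) = 1≢0 (O.antisym (subst₂ _≤_ refl (S.zeroʳ c) 1≤c0) 0≤1)

  large-↑ : ∀ {a b} → a ≤ b → Large a → Large b
  large-↑ a≤b (0≤a , c , 0≤c , 1≤ca) = O.trans 0≤a a≤b , c , 0≤c , O.trans 1≤ca (*-monoˡ a≤b 0≤c)

  -- The larger summand is at least half of the sum, so doubling the multiplier `c` suffices for it.
  large-+ : ∀ {a b} → 0# ≤ a → 0# ≤ b → Large (a + b) → Large a ⊎ Large b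
  large-+ {a} {b} 0≤a 0≤b (_ , c , 0≤c , 1≤) with O.total a b
  ... | inj₁ a≤b = inj₂ (0≤b , c + c , 0≤+ 0≤c 0≤c , O.trans 1≤ (subst₂ _≤_ refl
          (trans (S.distribˡ c b b) (sym (S.distribʳ b c c))) (*-monoˡ (+-mono b a≤b) 0≤c)))
  ... | inj₂ b≤a = inj₁ (0≤a , c + c , 0≤+ 0≤c 0≤c , O.trans 1≤ (subst₂ _≤_ (cong (c *_) (S.+-comm b a))
          (trans (S.distribˡ c a a) (sym (S.distribʳ a c c))) (*-monoˡ (+-mono a b≤a) 0≤c)))

  *-swap : ∀ a b c d → (a * b) * (c * d) ≡ (a * c) * (b * d)
  *-swap a b c d = trans (S.*-assoc a b (c * d)) (trans
    (cong (a *_) (trans (sym (S.*-assoc b c d)) (trans (cong (_* d) (S.*-comm b c)) (S.*-assoc c b d))))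
    (sym (S.*-assoc a c (b * d))))

  large-* : ∀ {a b} → Large a → Large b → Large (a * b)
  large-* {a} {b} (0≤a , c , 0≤c , 1≤ca) (0≤b , d , 0≤d , 1≤db) =
    0≤* 0≤a 0≤b , c * d , 0≤* 0≤c 0≤d ,
    O.trans 1≤ca (subst₂ _≤_ (S.*-identityʳ (c * a)) (*-swap c a d b) (*-monoˡ 1≤db (0≤* 0≤c 0≤a)))

  -- For each factor, the other one is absorbed into the multiplier.
  large-*⁻ : ∀ {a b} → 0# ≤ a → 0# ≤ b → Large (a * b) → Large a × Large b
  large-*⁻ {a} {b} 0≤a 0≤b (_ , c , 0≤c , 1≤) =
    (0≤a , c * b , 0≤* 0≤c 0≤b , subst₂ _≤_ refl
      (trans (cong (c *_) (S.*-comm a b)) (sym (S.*-assoc c b a))) 1≤) ,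
    (0≤b , c * a , 0≤* 0≤c 0≤a , subst₂ _≤_ refl (sym (S.*-assoc c a b)) 1≤)

  NonNeg : {V : Set} → Poly V → Set ℓ
  NonNeg = All (λ t → 0# ≤ proj₁ t)

  module _ {V : Set} (vs : List V) where

    _≐_ : Monomial V → Monomial V → Set
    μ ≐ ν = μ ≐[ vs ] ν

    _⊕_≐_ : Monomial V → Monomial V → Monomial V → Set
    μ ⊕ ν ≐ ρ = (λ v → μ v ℕ.+ ν v) ≐ ρ

    -- The support is read off single terms. Non-negative terms cannot cancel, so for non-negative
    -- `p` this amounts to a large coefficient at `μ`; see `coeff⇒Supp` and `Supp⇒coeff`.
    Supp : Poly V → Monomial V → Set ℓ
    Supp p μ = Any (λ t → Large (proj₁ t) × proj₂ t ≐ μ) p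

    Supp-resp : ∀ {p μ ν} → μ ≐ ν → Supp p μ → Supp p ν
    Supp-resp μ≐ν = Any.map (λ (l , e) → l , λ v v∈ → trans (e v v∈) (μ≐ν v v∈))

    coeff-nonNeg : ∀ {p} μ → NonNeg p → 0# ≤ coeff vs p μ
    coeff-nonNeg μ [] = O.refl
    coeff-nonNeg {t ∷ p} μ (0≤t ∷ 0≤p) with eqMon vs (proj₂ t) μ
    ... | true  = 0≤+ 0≤t (coeff-nonNeg μ 0≤p)
    ... | false = coeff-nonNeg μ 0≤p

    coeff⇒Supp : ∀ {p μ} → NonNeg p → Large (coeff vs p μ) → Supp p μ
    coeff⇒Supp [] l = ⊥-elim (¬large-0 l)
    coeff⇒Supp {t ∷ p} {μ} (0≤t ∷ 0≤p) l with eqMon vs (proj₂ t) μ in e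
    ... | false = there (coeff⇒Supp 0≤p l)
    ... | true with large-+ 0≤t (coeff-nonNeg μ 0≤p) l
    ...   | inj₁ lt = here (lt , eqMon-sound vs e)
    ...   | inj₂ lp = there (coeff⇒Supp 0≤p lp)

    Supp⇒coeff : ∀ {p μ} → NonNeg p → Supp p μ → Large (coeff vs p μ)
    Supp⇒coeff {t ∷ p} {μ} (0≤t ∷ 0≤p) (here (l , e)) rewrite eqMon-complete vs e =
      large-↑ (a≤a+b _ (coeff-nonNeg μ 0≤p)) l
    Supp⇒coeff {t ∷ p} {μ} (0≤t ∷ 0≤p) (there s) with eqMon vs (proj₂ t) μ
    ... | true  = large-↑ (b≤a+b _ 0≤t) (Supp⇒coeff 0≤p s)
    ... | false = Supp⇒coeff 0≤p s

    Supp-*⁻ : ∀ {p q μ} → NonNeg p → NonNeg q → Supp (p *P q) μ →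
      Σ (Monomial V) λ ν → Σ (Monomial V) λ ρ → Supp p ν × Supp q ρ × ν ⊕ ρ ≐ μ
    Supp-*⁻ {t ∷ p} {q} (0≤t ∷ 0≤p) 0≤q s with Any.++⁻ (map _ q) s
    ... | inj₂ s′ = let ν , ρ , sν , sρ , e = Supp-*⁻ 0≤p 0≤q s′ in ν , ρ , there sν , sρ , e
    ... | inj₁ s′ with find (Any.map⁻ s′)
    ...   | r , r∈ , l , e = let lt , lr = large-*⁻ 0≤t (All.lookup 0≤q r∈) l in
            proj₂ t , proj₂ r , here (lt , λ _ _ → refl) , lose r∈ (lr , λ _ _ → refl) , e

    Supp-*⁺ : ∀ {p q ν ρ} → Supp p ν → Supp q ρ → Supp (p *P q) (λ v → ν v ℕ.+ ρ v)
    Supp-*⁺ {t ∷ p} {q} (here (lt , et)) sρ = Any.++⁺ˡ (Any.map⁺ (Any.map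
      (λ (lr , er) → large-* lt lr , λ v v∈ → cong₂ ℕ._+_ (et v v∈) (er v v∈)) sρ))
    Supp-*⁺ {t ∷ p} {q} (there sν) sρ = Any.++⁺ʳ (map _ q) (Supp-*⁺ sν sρ)

    module _ {W : Set} (_≟W_ : DecidableEquality W) (L : W → Poly V) (L≥0 : ∀ w → NonNeg (L w)) where

      powers : List W → Monomial W → Poly V
      powers ws e = prodP (map (λ w → powP (L w) (e w)) ws)

      powP≥0 : ∀ w k → NonNeg (powP (L w) k)
      powP≥0 w k = All-powP {W = W} (λ t → 0# ≤ proj₁ t) 0≤1 0≤* k (L≥0 w)

      powers≥0 : ∀ ws e → NonNeg (powers ws e)
      powers≥0 ws e = All-prodP {W = W} (λ t → 0# ≤ proj₁ t) 0≤1 0≤*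
        (All.map⁺ (All.universal (λ w → powP≥0 w (e w)) ws))

      -- Multiplication by the variable `u`, in exactly the form in which `_*P_` with a `varP`
      -- produces exponents.
      bump : W → Monomial W → Monomial W
      bump u e w = (if ⌊ w ≟W u ⌋ then 1 else 0) ℕ.+ e w

      powers-∉ : ∀ ws {u} e → u ∉ ws → powers ws (bump u e) ≡ powers ws e
      powers-∉ []       e u∉ = refl
      powers-∉ (w ∷ ws) {u} e u∉ with w ≟W u
      ... | yes refl = ⊥-elim (u∉ (here refl))
      ... | no _     = cong (powP (L w) (e w) *P_) (powers-∉ ws e (u∉ ∘ there))

      powers-0⁻ : ∀ ws {μ} → Supp (powers ws unitM) μ → unitM ≐ μ
      powers-0⁻ []       (here (_ , e)) = e
      powers-0⁻ (w ∷ ws) s =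
        let ν , ρ , s₁ , s₂ , e = Supp-*⁻ (0≤1 ∷ []) (powers≥0 ws unitM) s
        in λ v v∈ → trans (cong₂ ℕ._+_ (one s₁ v v∈) (powers-0⁻ ws s₂ v v∈)) (e v v∈)
        where
        one : ∀ {ν} → Supp (constP 1#) ν → unitM ≐ ν
        one (here (_ , e)) = e

      powers-0⁺ : ∀ ws → Supp (powers ws unitM) unitM
      powers-0⁺ []       = here (large-1 , λ _ _ → refl)
      powers-0⁺ (w ∷ ws) = Supp-*⁺ {constP 1#} (here (large-1 , λ _ _ → refl)) (powers-0⁺ ws)

      -- Since `u` occurs exactly once in `ws`, raising its exponent by one adds exactly one factor
      -- `L u`.
      powers-bump⁻ : ∀ {ws u} e {μ} → Unique ws → u ∈ ws → Supp (powers ws (bump u e)) μ →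
        Σ (Monomial V) λ ν → Σ (Monomial V) λ ρ → Supp (L u) ν × Supp (powers ws e) ρ × ν ⊕ ρ ≐ μ
      powers-bump⁻ {w ∷ ws} {u} e (w∉ ∷ uniq) u∈ s with w ≟W u
      ... | yes refl rewrite powers-∉ ws e (λ w∈ → All.lookup w∉ w∈ refl) =
        let ν , ρ , s₁ , s₂ , e₁ = Supp-*⁻ (powP≥0 w (suc (e w))) (powers≥0 ws e) s
            α , β , s₃ , s₄ , e₂ = Supp-*⁻ (L≥0 w) (powP≥0 w (e w)) s₁
        in α , (λ v → β v ℕ.+ ρ v) , s₃ , Supp-*⁺ s₄ s₂ ,
           λ v v∈ → trans (sym (ℕ.+-assoc (α v) (β v) (ρ v))) (trans (cong (ℕ._+ ρ v) (e₂ v v∈)) (e₁ v v∈))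
      ... | no w≢u with u∈
      ...   | here u≡w = ⊥-elim (w≢u (sym u≡w))
      ...   | there u∈′ =
        let ν , ρ , s₁ , s₂ , e₁ = Supp-*⁻ (powP≥0 w (e w)) (powers≥0 ws (bump u e)) s
            α , β , s₃ , s₄ , e₂ = powers-bump⁻ e uniq u∈′ s₂
        in α , (λ v → ν v ℕ.+ β v) , s₃ , Supp-*⁺ s₁ s₄ ,
           λ v v∈ → trans (x∙yz≈y∙xz (α v) (ν v) (β v)) (trans (cong (ν v ℕ.+_) (e₂ v v∈)) (e₁ v v∈))

      powers-bump⁺ : ∀ {ws u} e {ν ρ} → Unique ws → u ∈ ws → Supp (L u) ν → Supp (powers ws e) ρ →
        Supp (powers ws (bump u e)) (λ v → ν v ℕ.+ ρ v)
      powers-bump⁺ {w ∷ ws} {u} e {ν} {ρ} (w∉ ∷ uniq) u∈ sν sρ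
        with Supp-*⁻ (powP≥0 w (e w)) (powers≥0 ws e) sρ
      ... | α , β , s₁ , s₂ , e₁ with w ≟W u
      ...   | yes refl rewrite powers-∉ ws e (λ w∈ → All.lookup w∉ w∈ refl) =
        Supp-resp (λ v v∈ → trans (ℕ.+-assoc (ν v) (α v) (β v)) (cong (ν v ℕ.+_) (e₁ v v∈)))
          (Supp-*⁺ (Supp-*⁺ sν s₁) s₂)
      ...   | no w≢u with u∈
      ...     | here u≡w = ⊥-elim (w≢u (sym u≡w))
      ...     | there u∈′ =
        Supp-resp (λ v v∈ → trans (x∙yz≈y∙xz (α v) (ν v) (β v)) (cong (ν v ℕ.+_) (e₁ v v∈)))
          (Supp-*⁺ s₁ (powers-bump⁺ e uniq u∈′ sν s₂))

      Supp-subst⁻ : ∀ {ws g μ} → NonNeg g → Supp (subst ws g L) μ →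
        Any (λ t → Supp (powers ws (proj₂ t)) μ) g
      Supp-subst⁻ {ws} {t ∷ g} (0≤t ∷ 0≤g) s with Any.++⁻ (scaleP (proj₁ t) (powers ws (proj₂ t))) s
      ... | inj₂ s′ = there (Supp-subst⁻ {ws} 0≤g s′)
      ... | inj₁ s′ with find (Any.map⁻ s′)
      ...   | r , r∈ , l , e =
              here (lose r∈ (proj₂ (large-*⁻ 0≤t (All.lookup (powers≥0 ws (proj₂ t)) r∈) l) , e))

      Supp-subst⁺ : ∀ {ws g μ} → Any (λ t → Large (proj₁ t) × Supp (powers ws (proj₂ t)) μ) g →
        Supp (subst ws g L) μ
      Supp-subst⁺ (here (l , s)) =
        Any.++⁺ˡ (Any.map⁺ (Any.map (λ (lr , e) → large-* l lr , e) s))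
      Supp-subst⁺ {ws} {t ∷ g} (there a) = Any.++⁺ʳ (scaleP (proj₁ t) (powers ws (proj₂ t))) (Supp-subst⁺ {ws} a)

      varProd : ∀ {k} → (Fin k → W) → Poly W
      varProd f = prodP (tabulate (λ i → varP _≟W_ (f i)))

      -- Supports of products are Minkowski sums: a monomial of the substituted product picks one
      -- support monomial from each form `L (f i)`.
      Supp-varProd⁻ : ∀ {k ws} (f : Fin k → W) {μ} → Unique ws → (∀ i → f i ∈ ws) →
        Any (λ t → Supp (powers ws (proj₂ t)) μ) (varProd f) →
        Σ (Fin k → Monomial V) λ s → (∀ i → Supp (L (f i)) (s i)) × (λ v → ∑[ i < k ] s i v) ≐ μ
      Supp-varProd⁻ {zero} {ws} f uniq f∈ (here s) = (λ ()) , (λ ()) , powers-0⁻ ws s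
      Supp-varProd⁻ {suc k} {ws} f uniq f∈ a with Any.++⁻ (map _ (varProd (f ∘ suc))) a
      ... | inj₁ a′ with find (Any.map⁻ a′)
      ...   | r , r∈ , s =
        let ν , ρ , sν , sρ , e₁ = powers-bump⁻ (proj₂ r) uniq (f∈ zero) s
            ss , Ls , e₂ = Supp-varProd⁻ (f ∘ suc) uniq (f∈ ∘ suc) (lose r∈ sρ)
        in (λ { zero → ν ; (suc i) → ss i }) , (λ { zero → sν ; (suc i) → Ls i }) ,
           λ v v∈ → trans (cong (ν v ℕ.+_) (e₂ v v∈)) (e₁ v v∈)

      Supp-varProd⁺ : ∀ {k ws} (f : Fin k → W) → Unique ws → (∀ i → f i ∈ ws) →
        (s : Fin k → Monomial V) → (∀ i → Supp (L (f i)) (s i)) →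
        Any (λ t → Large (proj₁ t) × Supp (powers ws (proj₂ t)) (λ v → ∑[ i < k ] s i v)) (varProd f)
      Supp-varProd⁺ {zero} {ws} f uniq f∈ s Ls = here (large-1 , powers-0⁺ ws)
      Supp-varProd⁺ {suc k} f uniq f∈ s Ls = Any.++⁺ˡ (Any.map⁺ (Any.map
        (λ {t} (l , sp) → large-* large-1 l , powers-bump⁺ (proj₂ t) uniq (f∈ zero) (Ls zero) sp)
        (Supp-varProd⁺ (f ∘ suc) uniq (f∈ ∘ suc) (s ∘ suc) (Ls ∘ suc))))

    Supp-affine : ∀ (_≟V_ : DecidableEquality V) a₀ a {μ} → Supp (affine _≟V_ vs a₀ a) μ →
      unitM ≐ μ ⊎ Σ V λ u → (λ w → if ⌊ w ≟V u ⌋ then 1 else 0) ≐ μ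
    Supp-affine _≟V_ a₀ a (here (_ , e)) = inj₁ e
    Supp-affine _≟V_ a₀ a {μ} (there s) = inj₂ (go vs s)
      where
      go : ∀ us → Supp (sumP (map (λ v → scaleP (a v) (varP _≟V_ v)) us)) μ →
        Σ V λ u → (λ w → if ⌊ w ≟V u ⌋ then 1 else 0) ≐ μ
      go (u ∷ us) (here (_ , e)) = u , e
      go (u ∷ us) (there s)      = go us s

-- From projections of the permanent to labelled matchings

module CutPerm {ℓ : Level} (R : TOSemiring ℓ) where
  open TOSemiring R
  open Poly R
  open Objects R
  open Terms R
  private
    module S = IsCommutativeSemiring isCommutativeSemiring
    module O = IsTotalOrder isTotalOrder

  -- All that the lower bound retains of a projection: `S w` is the support of the form substituted
  -- for `y_w`, with coefficients forgotten.
  record SupportProjection (q n m : ℕ) : Set (Level.suc ℓ) where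
    field
      S : Fin m × Fin m → Monomial (Fin n × Fin n) → Set ℓ
      generate : ∀ A → Σ (Fin m → Fin m) λ σ → Injective _≡_ _≡_ σ ×
        Σ (Fin m → Monomial (Fin n × Fin n)) λ s → (∀ i → S (i , σ i) (s i)) ×
        (λ v → ∑[ i < m ] s i v) ≐[ offDiag n ] cutMon q n A
      closed : ∀ σ → Injective _≡_ _≡_ σ → (s : Fin m → Monomial (Fin n × Fin n)) → (∀ i → S (i , σ i) (s i)) →
        Σ (Vec Bool n) λ A → (λ v → ∑[ i < m ] s i v) ≐[ offDiag n ] cutMon q n A
      label : ∀ {w μ} → S w μ → unitM ≐[ offDiag n ] μ ⊎
        Σ (Fin n × Fin n) λ u → (λ w → if ⌊ w ≟P u ⌋ then 1 else 0) ≐[ offDiag n ] μ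

  supportProjection : ∀ {q n m} → 0# ≤ 1# → CutProjPerm q n m → SupportProjection q n m
  supportProjection {q} {n} {m} 0≤1 (a₀ , a , 0≤a₀ , 0≤a , eqP) = record
    { S = λ w → Supp vs (L w)
    ; generate = generate
    ; closed = closed
    ; label = Supp-affine vs _≟P_ _ _
    }
    where
    open Support R 0≤1
    vs = offDiag n
    ws = pairs m
    L : Fin m × Fin m → Poly (Fin n × Fin n)
    L w = affine _≟P_ vs (a₀ w) (a w)

    L≥0 : ∀ w → NonNeg (L w)
    L≥0 w = All-affine _≟P_ (0≤a₀ w) (λ v v∈ → 0≤* (0≤a w v v∈) 0≤1)

    termOf : Vec (Fin m) m → Poly (Fin m × Fin m)
    termOf σ = prodP (map (λ i → varP _≟P_ (i , lookup σ i)) (allFin m))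

    termOf≡ : ∀ σ → termOf σ ≡ varProd vs _≟P_ L L≥0 (λ i → i , lookup σ i)
    termOf≡ σ = cong prodP (map-tabulate (λ i → i) (λ i → varP _≟P_ (i , lookup σ i)))

    perm≥0 : NonNeg (perm m)
    perm≥0 = All-sumP (All.map⁺ (All.universal (λ σ →
      All-prodP {W = Fin m} (λ t → 0# ≤ proj₁ t) 0≤1 0≤* (All.map⁺ (All.universal (λ i → 0≤1 ∷ []) (allFin m))))
      (permutations m)))

    subst≥0 : NonNeg (subst ws (perm m) L)
    subst≥0 = All-subst (λ t → 0# ≤ proj₁ t) 0≤1 0≤* {C = 0# ≤_} 0≤* {ws = ws} perm≥0 L≥0

    Cut≥0 : NonNeg (Cut q n)
    Cut≥0 = All.map⁺ (All.universal (λ _ → 0≤1) (subsets n))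

    in-sumP⁻ : ∀ {P : Carrier × Monomial (Fin m × Fin m) → Set ℓ} σs →
      Any P (sumP (map termOf σs)) → Σ (Vec (Fin m) m) λ σ → σ ∈ σs × Any P (termOf σ)
    in-sumP⁻ (σ ∷ σs) a with Any.++⁻ (termOf σ) a
    ... | inj₁ a′ = σ , here refl , a′
    ... | inj₂ a′ = let τ , τ∈ , b = in-sumP⁻ σs a′ in τ , there τ∈ , b

    in-sumP⁺ : ∀ {P : Carrier × Monomial (Fin m × Fin m) → Set ℓ} {σ σs} →
      σ ∈ σs → Any P (termOf σ) → Any P (sumP (map termOf σs))
    in-sumP⁺ (here refl) b = Any.++⁺ˡ b
    in-sumP⁺ {σs = τ ∷ _} (there σ∈) b = Any.++⁺ʳ (termOf τ) (in-sumP⁺ σ∈ b)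

    generate : ∀ A → Σ (Fin m → Fin m) λ σ → Injective _≡_ _≡_ σ ×
        Σ (Fin m → Monomial (Fin n × Fin n)) λ s → (∀ i → Supp vs (L (i , σ i)) (s i)) ×
        (λ v → ∑[ i < m ] s i v) ≐[ vs ] cutMon q n A
    generate A =
      let inCut = lose (∈-map⁺ (λ A → (1# , cutMon q n A)) (subsets-complete A)) (large-1 , λ _ _ → refl)
          -- A cut monomial has a large coefficient in `Cut q n`; `eqP` carries this over to the
          -- substituted permanent, so some permutation produces it.
          large = Eq.subst Large (eqP (cutMon q n A)) (Supp⇒coeff vs Cut≥0 inCut)
          a     = Supp-subst⁻ vs _≟P_ L L≥0 {ws} perm≥0 (coeff⇒Supp vs subst≥0 large)
          σ , σ∈ , b = in-sumP⁻ (permutations m) a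
      in lookup σ , permutations-sound σ∈ ,
         Supp-varProd⁻ vs _≟P_ L L≥0 (λ i → i , lookup σ i) (pairs-unique m) (λ i → pairs-complete _)
           (Eq.subst (Any _) (termOf≡ σ) b)

    closed : ∀ σ → Injective _≡_ _≡_ σ → (s : Fin m → Monomial (Fin n × Fin n)) → (∀ i → Supp vs (L (i , σ i)) (s i)) →
        Σ (Vec Bool n) λ A → (λ v → ∑[ i < m ] s i v) ≐[ vs ] cutMon q n A
    closed τ inj s Ls =
      let σ = Vec.tabulate τ
          b = Supp-varProd⁺ vs _≟P_ L L≥0 (λ i → i , lookup σ i) (pairs-unique m) (λ i → pairs-complete _) s
                (λ i → Eq.subst (λ j → Supp vs (L (i , j)) (s i)) (sym (lookup∘tabulate τ i)) (Ls i))
          a = in-sumP⁺ (permutations-complete τ inj) (Eq.subst (Any _) (sym (termOf≡ σ)) b)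
          -- The product survives in the substituted permanent because nothing cancels; by `eqP` it
          -- occurs in `Cut q n`, hence is a cut monomial.
          large = Supp⇒coeff vs subst≥0 (Supp-subst⁺ vs _≟P_ L L≥0 {ws} a)
          t , t∈ , _ , e = find (coeff⇒Supp vs Cut≥0 (Eq.subst Large (sym (eqP _)) large))
          A , _ , t≡ = find (Any.map⁻ t∈)
      in A , λ v v∈ → sym (trans (cong (λ t → proj₂ t v) (sym t≡)) (e v v∈))

  -- If 1 ≤ 0 then 0 is the only non-negative element, so projections of perm are constant.
  1≰0 : ∀ {q n m} → 2 ℕ.≤ q → 1# ≤ 0# → ¬ CutProjPerm q (suc (suc n)) m
  1≰0 {q} {n} {m} 2≤q 1≤0 (a₀ , a , 0≤a₀ , 0≤a , eqP) =
    1≢0 (O.antisym 1≤0 (O.trans (O.reflexive (sym (trans (eqP μ) (proj-coeff _ const-terms)))) (cut-coeff _ (subsets-complete A))))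
    where
    A : Vec Bool (suc (suc n))
    A = true ∷ false ∷ Vec.replicate n false
    vs = offDiag (suc (suc n))
    μ = cutMon q (suc (suc n)) A

    -- The set `A` contains vertex 0 but not vertex 1, so this variable has exponent q - 1 ≥ 1 in
    -- `μ`.
    v₀ : Fin (suc (suc n)) × Fin (suc (suc n))
    v₀ = zero , suc zero

    μ≢0 : μ v₀ ≢ 0
    μ≢0 = ℕ.m>n⇒m∸n≢0 2≤q

    nonNeg⇒0 : ∀ {x} → 0# ≤ x → x ≡ 0#
    nonNeg⇒0 {x} 0≤x = O.antisym (subst₂ _≤_ (S.*-identityˡ x) (S.zeroˡ x) (*-mono 1≤0 0≤x)) 0≤x

    -- An invariant of all terms of the projection: the coefficient vanishes or `v₀` does not occur.
    -- Neither kind contributes to the coefficient of `μ`.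
    T : Carrier × Monomial (Fin (suc (suc n)) × Fin (suc (suc n))) → Set ℓ
    T t = proj₁ t ≡ 0# ⊎ proj₂ t v₀ ≡ 0

    T-* : ∀ {t s} → T t → T s → T (proj₁ t * proj₁ s , λ v → proj₂ t v ℕ.+ proj₂ s v)
    T-* {_} {s} (inj₁ e) _ = inj₁ (trans (cong (_* proj₁ s) e) (S.zeroˡ _))
    T-* {t} (inj₂ _) (inj₁ e) = inj₁ (trans (cong (proj₁ t *_) e) (S.zeroʳ _))
    T-* {_ , _} {_ , _} (inj₂ e) (inj₂ e′) = inj₂ (cong₂ ℕ._+_ e e′)

    T-scale : ∀ {x t} → ⊤ {ℓ} → T t → T (x * proj₁ t , proj₂ t)
    T-scale {x} _ (inj₁ e) = inj₁ (trans (cong (x *_) e) (S.zeroʳ x))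
    T-scale {t = _ , _} _ (inj₂ e) = inj₂ e

    const-terms : All T (subst (pairs m) (perm m) (λ w → affine _≟P_ vs (a₀ w) (a w)))
    const-terms = All-subst T (inj₂ refl) (λ {t} {s} → T-* {t} {s}) {C = λ _ → ⊤} (λ {x} {t} → T-scale {x} {t}) {ws = pairs m}
      (All.universal (λ _ → tt) (perm m))
      λ w → All-affine _≟P_ (inj₂ refl)
        λ v v∈ → inj₁ (trans (cong (_* 1#) (nonNeg⇒0 (0≤a w v v∈))) (S.zeroˡ 1#))

    proj-coeff : ∀ p → All T p → coeff vs p μ ≡ 0#
    proj-coeff []      []       = refl
    proj-coeff (t ∷ p) (Tt ∷ Tp) with eqMon vs (proj₂ t) μ in e
    ... | false = proj-coeff p Tp
    ... | true with Tt
    ...   | inj₁ t≡0 = trans (cong₂ _+_ t≡0 (proj-coeff p Tp)) (S.+-identityˡ 0#)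
    ...   | inj₂ t≡0 = ⊥-elim (μ≢0 (trans (sym (eqMon-sound vs e v₀ (offDiag-complete (λ ())))) t≡0))

    cut-coeff≤0 : ∀ As → coeff vs (map (λ A → (1# , cutMon q (suc (suc n)) A)) As) μ ≤ 0#
    cut-coeff≤0 [] = O.refl
    cut-coeff≤0 (B ∷ As) with eqMon vs (cutMon q (suc (suc n)) B) μ
    ... | false = cut-coeff≤0 As
    ... | true  = O.trans (+-mono _ 1≤0) (subst₂ _≤_ (sym (S.+-identityˡ _)) refl (cut-coeff≤0 As))

    -- One occurrence of `μ` gives 1, and every further 1 can only lower the sum because 1 ≤ 0.
    cut-coeff : ∀ As → A ∈ As → coeff vs (map (λ A → (1# , cutMon q (suc (suc n)) A)) As) μ ≤ 1#
    cut-coeff (B ∷ As) (here refl) rewrite eqMon-complete vs {μ} {μ} (λ _ _ → refl) =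
      subst₂ _≤_ (S.+-comm _ 1#) (S.+-identityˡ 1#) (+-mono 1# (cut-coeff≤0 As))
    cut-coeff (B ∷ As) (there A∈) with eqMon vs (cutMon q (suc (suc n)) B) μ
    ... | false = cut-coeff As A∈
    ... | true  = O.trans (+-mono _ 1≤0) (subst₂ _≤_ (sym (S.+-identityˡ _)) refl (cut-coeff As A∈))

-- Finite sums of natural numbers

open import Data.Nat using (_+_; _*_; _∸_; _^_; _≤_; _<_; _≤?_; _⊔_; NonZero)
open import Data.Nat.DivMod using (_/_; _%_; m≡m%n+[m/n]*n; m%n<n)
open import Data.Nat.Properties hiding (_≟_)
open import Data.Nat.Tactic.RingSolver using (solve-∀)
open import Relation.Binary.PropositionalEquality using (subst)

𝟙 : Bool → ℕ
𝟙 true  = 1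
𝟙 false = 0

eq : ∀ {n} → Fin n → Fin n → ℕ
eq i j = 𝟙 (does (i ≟ j))

eq-refl : ∀ {n} (i : Fin n) → eq i i ≡ 1
eq-refl i with i ≟ i
... | yes _   = refl
... | no i≢i = ⊥-elim (i≢i refl)

eq-≢ : ∀ {n} {i j : Fin n} → i ≢ j → eq i j ≡ 0
eq-≢ {i = i} {j} i≢j with i ≟ j
... | yes i≡j = ⊥-elim (i≢j i≡j)
... | no _    = refl

sum-mono : ∀ {n} {f g : Fin n → ℕ} → (∀ i → f i ≤ g i) → sum f ≤ sum g
sum-mono {zero}  f≤g = z≤n
sum-mono {suc n} f≤g = +-mono-≤ (f≤g zero) (sum-mono (f≤g ∘ suc))

sum-const : ∀ n c → ∑[ i < n ] c ≡ n * c
sum-const zero    c = refl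
sum-const (suc n) c = cong (c +_) (sum-const n c)

sum-zero : ∀ {n} {f : Fin n → ℕ} → (∀ i → f i ≡ 0) → sum f ≡ 0
sum-zero {n} f≡0 = trans (sum-cong-≗ f≡0) (trans (sum-const n 0) (*-zeroʳ n))

term≤sum : ∀ {n} (f : Fin n → ℕ) i → f i ≤ sum f
term≤sum f zero    = m≤m+n _ _
term≤sum f (suc i) = ≤-trans (term≤sum (f ∘ suc) i) (m≤n+m _ _)

sum-≢0 : ∀ {n} (f : Fin n → ℕ) → sum f ≢ 0 → Σ (Fin n) λ i → f i ≢ 0
sum-≢0 {zero}  f ne = ⊥-elim (ne refl)
sum-≢0 {suc n} f ne with f zero in fz
... | suc _ = zero , λ fz≡0 → 1+n≢0 (trans (sym fz) fz≡0)
... | zero  = let i , fi = sum-≢0 (f ∘ suc) ne in suc i , fi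

sum-tight : ∀ {n} {f g : Fin n → ℕ} → (∀ i → f i ≤ g i) → sum g ≤ sum f → ∀ i → f i ≡ g i
sum-tight {suc n} {f} {g} f≤g Σg≤Σf zero = ≤-antisym (f≤g zero)
  (+-cancelʳ-≤ (sum (f ∘ suc)) _ _
    (≤-trans (+-monoʳ-≤ (g zero) (sum-mono (f≤g ∘ suc))) Σg≤Σf))
sum-tight {suc n} {f} {g} f≤g Σg≤Σf (suc i) = sum-tight (f≤g ∘ suc)
  (+-cancelˡ-≤ (f zero) _ _ (≤-trans (+-monoˡ-≤ _ (f≤g zero)) Σg≤Σf)) i

sum-eq : ∀ {n} (i : Fin n) (g : Fin n → ℕ) → ∑[ j < n ] (eq i j * g j) ≡ g i
sum-eq {suc n} zero g = trans (cong₂ _+_ (*-identityˡ (g zero))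
  (sum-zero {f = λ j → eq zero (suc j) * g (suc j)} (λ _ → refl))) (+-identityʳ _)
sum-eq {suc n} (suc i) g = sum-eq i (g ∘ suc)

sum-eq-1 : ∀ {n} (i : Fin n) → ∑[ j < n ] eq i j ≡ 1
sum-eq-1 i = trans (sum-cong-≗ (λ j → sym (*-identityʳ (eq i j)))) (sum-eq i (λ _ → 1))

fibre≤1 : ∀ {n k} (τ : Fin n → Fin k) → Injective _≡_ _≡_ τ → ∀ j → ∑[ i < n ] eq (τ i) j ≤ 1
fibre≤1 {zero}  τ inj j = z≤n
fibre≤1 {suc n} τ inj j with τ zero ≟ j
... | no _     = fibre≤1 (τ ∘ suc) (λ e → suc-injectiveᶠ (inj e)) j
... | yes refl = s≤s (≤-reflexive (sum-zero {f = λ i → eq (τ (suc i)) (τ zero)} λ i → eq-≢ λ e → 0≢suc (inj e)))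
  where
  0≢suc : ∀ {i : Fin n} → suc i ≢ zero
  0≢suc ()

-- Pigeonhole by double counting: there are n preimages in total and at most one for each `j`, so no
-- bound is slack.
fibre≡1 : ∀ {n} (τ : Fin n → Fin n) → Injective _≡_ _≡_ τ → ∀ j → ∑[ i < n ] eq (τ i) j ≡ 1
fibre≡1 {n} τ inj = sum-tight (fibre≤1 τ inj) (≤-reflexive (begin
  ∑[ j < n ] 1                        ≡⟨ sum-cong-≗ (λ i → sym (sum-eq-1 (τ i))) ⟩
  ∑[ i < n ] (∑[ j < n ] eq (τ i) j)  ≡⟨ ∑-comm (λ i j → eq (τ i) j) ⟩
  ∑[ j < n ] (∑[ i < n ] eq (τ i) j)  ∎))
  where open ≡-Reasoning

-- Hall's theorem

count : ∀ {n} → (Fin n → Bool) → ℕ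
count I = sum (𝟙 ∘ I)

-- K stands for any superset of the neighbourhood of I, which need not be decidable.
Hall : ∀ {m n} → (Fin m → Fin n → Set) → Set
Hall A = ∀ I K → (∀ i j → I i ≡ true → A i j → K j ≡ true) → count I ≤ count K

restrict : ∀ {m n} → Fin m → (Fin n → Set) → (Fin m → Fin n → Set) → Fin m → Fin n → Set
restrict i X A x j = A x j × (x ≡ i → X j)

Hall-mono : ∀ {m n} {A B : Fin m → Fin n → Set} → (∀ i j → A i j → B i j) → Hall A → Hall B
Hall-mono A⊆B hall I K cl = hall I K (λ i j Ii Aij → cl i j Ii (A⊆B i j Aij))

single : ∀ {n} → Fin n → Fin n → Bool
single i x = does (i ≟ x)

Hall-row : ∀ {m n} {A : Fin m → Fin n → Set} → Hall A → ∀ i → ¬ (∀ j → ¬ A i j)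
Hall-row {m} {n} {A} hall i empty = <⇒≱ (≤-reflexive (sym (sum-eq-1 i))) (≤-trans
  (hall (single i) (λ _ → false) cl) (≤-reflexive (sum-zero {n} {λ _ → 0} (λ _ → refl))))
  where
  cl : ∀ x j → single i x ≡ true → A x j → false ≡ true
  cl x j s Axj with i ≟ x
  cl x j s Axj | yes refl = ⊥-elim (empty j Axj)

∧-trueˡ : ∀ {a b} → a ∧ b ≡ true → a ≡ true
∧-trueˡ {true} _ = refl

∧-trueʳ : ∀ {a b} → a ∧ b ≡ true → b ≡ true
∧-trueʳ {true} e = e

∨-trueʳ : ∀ a {b} → b ≡ true → a ∨ b ≡ true
∨-trueʳ true  _ = refl
∨-trueʳ false e = e

𝟙-∨-∧ : ∀ a b → 𝟙 (a ∨ b) + 𝟙 (a ∧ b) ≡ 𝟙 a + 𝟙 b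
𝟙-∨-∧ true  true  = refl
𝟙-∨-∧ true  false = refl
𝟙-∨-∧ false b     = +-identityʳ _

count-∨-∧ : ∀ {n} (I J : Fin n → Bool) →
  count (λ x → I x ∨ J x) + count (λ x → I x ∧ J x) ≡ count I + count J
count-∨-∧ I J = begin
  count (λ x → I x ∨ J x) + count (λ x → I x ∧ J x)  ≡⟨ sym (∑-distrib-+ (λ x → 𝟙 (I x ∨ J x)) _) ⟩
  sum (λ x → 𝟙 (I x ∨ J x) + 𝟙 (I x ∧ J x))          ≡⟨ sum-cong-≗ (λ x → 𝟙-∨-∧ (I x) (J x)) ⟩
  sum (λ x → 𝟙 (I x) + 𝟙 (J x))                      ≡⟨ ∑-distrib-+ (𝟙 ∘ I) (𝟙 ∘ J) ⟩
  count I + count J                                   ∎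
  where open ≡-Reasoning

count-remove : ∀ {n} (I : Fin n → Bool) i → I i ≡ true →
  count I ≡ count (λ x → I x ∧ not (single i x)) + 1
count-remove I i Ii = begin
  count I                                             ≡⟨ sum-cong-≗ pointwise ⟩
  sum (λ x → 𝟙 (I x ∧ not (single i x)) + eq i x)     ≡⟨ ∑-distrib-+ _ (eq i) ⟩
  count (λ x → I x ∧ not (single i x)) + sum (eq i)   ≡⟨ cong (count (λ x → I x ∧ not (single i x)) +_) (sum-eq-1 i) ⟩
  count (λ x → I x ∧ not (single i x)) + 1            ∎
  where
  open ≡-Reasoning
  pointwise : ∀ x → 𝟙 (I x) ≡ 𝟙 (I x ∧ not (single i x)) + eq i x
  pointwise x with i ≟ x
  pointwise x | yes refl rewrite Ii = refl
  pointwise x | no _ with I x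
  ... | true  = refl
  ... | false = refl

-- Rado's submodularity argument: if both restrictions violate Hall's condition,
-- then the union and the intersection of the violating sets cannot both satisfy it.
Hall-split : ∀ {m n} {A : Fin m → Fin n → Set} → Hall A → ∀ i {X Y : Fin n → Set} →
  (∀ j → A i j → X j ⊎ Y j) → ¬ ¬ (Hall (restrict i X A) ⊎ Hall (restrict i Y A))
Hall-split {m} {n} {A} hall i {X} {Y} cover k = k (inj₁ left)
  where
  -- Restricting row `i` does not affect a set of rows that avoids `i`.
  without : ∀ {Z : Fin n → Set} I K → I i ≡ false →
    (∀ x j → I x ≡ true → restrict i Z A x j → K j ≡ true) → count I ≤ count K
  without I K Ii cl = hall I K λ x j Ix Axj → cl x j Ix
    (Axj , λ { refl → ⊥-elim (false≢true (trans (sym Ii) Ix)) })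
    where
    false≢true : false ≢ true
    false≢true ()

  module _ (I : Fin m → Bool) (K : Fin n → Bool) (clI : ∀ x j → I x ≡ true → restrict i X A x j → K j ≡ true)
           (I>K : ¬ count I ≤ count K)
           (J : Fin m → Bool) (L : Fin n → Bool) (clJ : ∀ x j → J x ≡ true → restrict i Y A x j → L j ≡ true)
           (J>L : ¬ count J ≤ count L) where

    -- Row `i` must leave the intersection: `cover` sends its neighbours into `K` or `L`, not into
    -- both. This costs 1, which the two strict violations outweigh.
    W : Fin m → Bool
    W x = (I x ∧ J x) ∧ not (single i x)

    union : I i ≡ true → J i ≡ true → ∀ x j → I x ∨ J x ≡ true → A x j → K j ∨ L j ≡ true
    union Ii Ji x j IJ Axj with i ≟ x
    union Ii Ji x j IJ Axj | yes refl with cover j Axj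
    ... | inj₁ Xj rewrite clI i j Ii (Axj , λ _ → Xj) = refl
    ... | inj₂ Yj = ∨-trueʳ (K j) (clJ i j Ji (Axj , λ _ → Yj))
    union Ii Ji x j IJ Axj | no i≢x with I x in Ix
    ... | true rewrite clI x j Ix (Axj , λ e → ⊥-elim (i≢x (sym e))) = refl
    ... | false = ∨-trueʳ (K j) (clJ x j IJ (Axj , λ e → ⊥-elim (i≢x (sym e))))

    inter : ∀ x j → W x ≡ true → A x j → K j ∧ L j ≡ true
    inter x j Wx Axj with i ≟ x | ∧-trueʳ {I x ∧ J x} Wx
    ... | no i≢x | _
      rewrite clI x j (∧-trueˡ (∧-trueˡ {I x ∧ J x} Wx)) (Axj , λ e → ⊥-elim (i≢x (sym e)))
            | clJ x j (∧-trueʳ {I x} (∧-trueˡ {I x ∧ J x} Wx)) (Axj , λ e → ⊥-elim (i≢x (sym e))) = refl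

    contra : ⊥
    contra with I i in Ii | J i in Ji
    ... | false | _     = I>K (without I K Ii clI)
    ... | true  | false = J>L (without J L Ji clJ)
    ... | true  | true  = <-irrefl refl (begin-strict
      count I + count J                          ≡⟨ sym (count-∨-∧ I J) ⟩
      count I∪J + count (λ x → I x ∧ J x)        ≡⟨ cong (count I∪J +_) (count-remove (λ x → I x ∧ J x) i (cong₂ _∧_ Ii Ji)) ⟩
      count I∪J + (count W + 1)                  ≡⟨ sym (+-assoc (count I∪J) (count W) 1) ⟩
      (count I∪J + count W) + 1                  ≤⟨ +-monoˡ-≤ 1 (+-mono-≤ (hall I∪J (λ j → K j ∨ L j) (union Ii Ji)) (hall W (λ j → K j ∧ L j) inter)) ⟩
      (count (λ j → K j ∨ L j) + count (λ j → K j ∧ L j)) + 1  ≡⟨ cong (_+ 1) (count-∨-∧ K L) ⟩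
      (count K + count L) + 1                    <⟨ n<1+n _ ⟩
      suc ((count K + count L) + 1)              ≡⟨ cong suc (trans (+-comm _ 1) (sym (+-suc (count K) (count L)))) ⟩
      suc (count K) + suc (count L)              ≤⟨ +-mono-≤ (≰⇒> I>K) (≰⇒> J>L) ⟩
      count I + count J                          ∎)
      where
      open ≤-Reasoning
      I∪J : Fin m → Bool
      I∪J x = I x ∨ J x

  -- Comparing counts is decidable once violating sets are given; only the choice between the two
  -- restrictions needs the double negation.
  left : Hall (restrict i X A)
  left I K clI with count I ≤? count K
  ... | yes I≤K = I≤K
  ... | no I>K = ⊥-elim (k (inj₂ right))
    where
    right : Hall (restrict i Y A)
    right J L clJ with count J ≤? count L
    ... | yes J≤L = J≤L
    ... | no J>L = ⊥-elim (contra I K clI I>K J L clJ J>L)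

-- Split the candidates for row `i` into the head of the list and the rest until one column remains;
-- an empty list would contradict Hall's condition for the row alone.
Hall-singleton : ∀ {m n} {A : Fin m → Fin n → Set} (xs : List (Fin n)) → Hall A → ∀ i →
  (∀ j → A i j → j ∈ xs) → ¬ ¬ (Σ (Fin n) λ x → Hall (restrict i (_≡ x) A))
Hall-singleton [] hall i A⊆xs k = Hall-row hall i (λ j Aij → Any.¬Any[] (A⊆xs j Aij))
Hall-singleton {n = n} {A} (x ∷ xs) hall i A⊆xs k = Hall-split hall i {_≡ x} {_∈ xs} cover λ where
    (inj₁ h) → k (x , h)
    (inj₂ h) → Hall-singleton xs h i (λ j A'ij → proj₂ A'ij refl) λ (y , h') →
      k (y , Hall-mono (λ _ _ ((Axj , _) , e) → Axj , e) h')
  where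
  cover : ∀ j → A i j → j ≡ x ⊎ j ∈ xs
  cover j Aij with A⊆xs j Aij
  ... | here e  = inj₁ e
  ... | there e = inj₂ e

-- Rows are treated one after another; later restrictions only shrink the relation, so rows already
-- reduced to one column stay so.
Hall-singletons : ∀ {m n} {A : Fin m → Fin n → Set} → Hall A → (is : List (Fin m)) →
  ¬ ¬ (Σ (Fin m → Fin n → Set) λ B → Hall B × (∀ i j → B i j → A i j) ×
       (∀ i → i ∈ is → Σ (Fin n) λ x → ∀ j → B i j → j ≡ x))
Hall-singletons {A = A} hall [] k = k (A , hall , (λ _ _ a → a) , λ _ ())
Hall-singletons hall (i ∷ is) k =
  Hall-singletons hall is λ (B , hallB , B⊆A , sing) →
  Hall-singleton (allFin _) hallB i (λ j _ → ∈-allFin j) λ (x , h) →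
  k (restrict i (_≡ x) B , h , (λ y j (b , _) → B⊆A y j b) , λ where
    y (here refl) → x , λ j (_ , e) → e refl
    y (there y∈is) → let z , f = sing y y∈is in z , λ j (b , _) → f j b)

-- Once every row has at most one column, two rows sharing a column would violate Hall's condition.
-- As `A` need not be decidable, its edges are obtained only up to double negation.
Hall-matching : ∀ {m n} {A : Fin m → Fin n → Set} → Hall A →
  ¬ ¬ (Σ (Fin m → Fin n) λ τ → Injective _≡_ _≡_ τ × ∀ i → ¬ ¬ A i (τ i))
Hall-matching {m} {n} {A} hall k = Hall-singletons hall (allFin m) λ (B , hallB , B⊆A , sing) →
  let τ : Fin m → Fin n
      τ i = proj₁ (sing i (∈-allFin i))
      Bτ : ∀ i j → B i j → j ≡ τ i
      Bτ i = proj₂ (sing i (∈-allFin i))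
  in k (τ , injective B hallB τ Bτ , λ i ¬Aiτi → Hall-row hallB i λ j Bij →
         ¬Aiτi (subst (A i) (Bτ i j Bij) (B⊆A i j Bij)))
  where
  ∨-cases : ∀ a {b} → a ∨ b ≡ true → a ≡ true ⊎ b ≡ true
  ∨-cases true  _ = inj₁ refl
  ∨-cases false e = inj₂ e

  single⇒≡ : ∀ {k} (i x : Fin k) → single i x ≡ true → i ≡ x
  single⇒≡ i x s with i ≟ x
  ... | yes i≡x = i≡x

  single-refl : ∀ {k} (i : Fin k) → single i i ≡ true
  single-refl i with i ≟ i
  ... | yes _ = refl
  ... | no ne = ⊥-elim (ne refl)

  injective : ∀ B → Hall B → (τ : Fin m → Fin n) → (∀ i j → B i j → j ≡ τ i) → Injective _≡_ _≡_ τ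
  injective B hallB τ Bτ {x} {y} τx≡τy with x ≟ y
  ... | yes x≡y = x≡y
  ... | no x≢y = ⊥-elim (<⇒≱ (n<1+n 1) (begin
    2                                          ≡⟨ sym (cong₂ _+_ (sum-eq-1 x) (sum-eq-1 y)) ⟩
    sum (eq x) + sum (eq y)                    ≡⟨ sym (∑-distrib-+ (eq x) (eq y)) ⟩
    sum (λ i → eq x i + eq y i)                ≡⟨ sum-cong-≗ disjoint ⟩
    count (λ i → single x i ∨ single y i)      ≤⟨ hallB (λ i → single x i ∨ single y i) (single (τ x)) closed ⟩
    count (single (τ x))                       ≡⟨ sum-eq-1 (τ x) ⟩
    1                                          ∎))
    where
    open ≤-Reasoning
    disjoint : ∀ i → eq x i + eq y i ≡ 𝟙 (single x i ∨ single y i)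
    disjoint i with x ≟ i | y ≟ i
    ... | yes refl | yes refl = ⊥-elim (x≢y refl)
    ... | yes _ | no _  = refl
    ... | no _  | yes _ = refl
    ... | no _  | no _  = refl
    closed : ∀ i j → single x i ∨ single y i ≡ true → B i j → single (τ x) j ≡ true
    closed i j s Bij with ∨-cases (single x i) s
    ... | inj₁ sx rewrite single⇒≡ x i sx | Bτ i j Bij = single-refl (τ i)
    ... | inj₂ sy rewrite τx≡τy | single⇒≡ y i sy | Bτ i j Bij = single-refl (τ i)

-- Double counting: the `count I * suc k` edges leaving `I` all end in `K`, which receives
-- `count K * suc k`.
Hall-regular : ∀ {m n} k (X : Fin m → Fin n → ℕ) → (∀ i → ∑[ j < n ] X i j ≡ suc k) →
  (∀ j → ∑[ i < m ] X i j ≡ suc k) → Hall (λ i j → X i j ≢ 0)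
Hall-regular {m} {n} k X rows cols I K cl = *-cancelʳ-≤ (count I) (count K) (suc k) (begin
  count I * suc k                              ≡⟨ *-distribʳ-sum (suc k) (𝟙 ∘ I) ⟩
  ∑[ i < m ] (𝟙 (I i) * suc k)                 ≡⟨ sum-cong-≗ (λ i → trans (cong (𝟙 (I i) *_) (sym (rows i))) (*-distribˡ-sum (𝟙 (I i)) (X i))) ⟩
  ∑[ i < m ] (∑[ j < n ] (𝟙 (I i) * X i j))    ≤⟨ sum-mono (λ i → sum-mono (pointwise i)) ⟩
  ∑[ i < m ] (∑[ j < n ] (𝟙 (K j) * X i j))    ≡⟨ ∑-comm (λ i j → 𝟙 (K j) * X i j) ⟩
  ∑[ j < n ] (∑[ i < m ] (𝟙 (K j) * X i j))    ≡⟨ sum-cong-≗ (λ j → trans (sym (*-distribˡ-sum (𝟙 (K j)) (λ i → X i j))) (cong (𝟙 (K j) *_) (cols j))) ⟩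
  ∑[ j < n ] (𝟙 (K j) * suc k)                 ≡⟨ sym (*-distribʳ-sum (suc k) (𝟙 ∘ K)) ⟩
  count K * suc k                              ∎)
  where
  open ≤-Reasoning
  pointwise : ∀ i j → 𝟙 (I i) * X i j ≤ 𝟙 (K j) * X i j
  pointwise i j with I i in Ii | X i j in Xij
  ... | false | _ = z≤n
  ... | true | zero = z≤n
  ... | true | suc x rewrite cl i j Ii (λ e → 1+n≢0 (trans (sym Xij) e)) = ≤-refl

-- Exchange of labelled edges between matchings

-- m matchings on m rows: the r-th one sends row i to column σ r i.
-- Z r i is the multiplicity of its edge at row i.
module Exchange {m : ℕ} (σ : Fin m → Fin m → Fin m) where

  total : (Fin m → Fin m → ℕ) → (Fin m → Fin m → ℕ) → ℕ
  total Z w = ∑[ i < m ] (∑[ r < m ] (Z r i * w r i))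

  -- The first component fixes the row degrees; weighting edges by `eq (σ r i) j` makes the second
  -- one fix the degree of column `j`.
  Regular : ℕ → (Fin m → Fin m → ℕ) → Set
  Regular k Z = (∀ i → ∑[ r < m ] Z r i ≡ k) × (∀ j → total Z (λ r i → eq (σ r i) j) ≡ k)

  -- Row `i` takes its edge from the matching numbered `ρ i`; injectivity makes the mixture a
  -- matching again.
  Transversal : (Fin m → Fin m) → Set
  Transversal ρ = Injective _≡_ _≡_ (λ i → σ (ρ i) i)

  peel : ∀ {k} Z → Regular (suc k) Z → ∀ ρ → (∀ i → Z (ρ i) i ≢ 0) → Transversal ρ →
    Σ (Fin m → Fin m → ℕ) λ Z′ → Regular k Z′ ×
      (∀ w → total Z w ≡ total Z′ w + ∑[ i < m ] w (ρ i) i)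
  peel {k} Z (rows , cols) ρ Zρ inj = Z′ , (rows′ , cols′) , split
    where
    open ≡-Reasoning
    Z′ : Fin m → Fin m → ℕ
    -- The truncated subtraction is exact because `Zρ` makes the chosen multiplicities positive.
    Z′ r i = Z r i ∸ eq (ρ i) r

    Z≡ : ∀ r i → Z r i ≡ Z′ r i + eq (ρ i) r
    Z≡ r i with ρ i ≟ r
    ... | no _ = sym (+-identityʳ _)
    ... | yes refl = sym (m∸n+n≡m (n≢0⇒n>0 (Zρ i)))

    split : ∀ w → total Z w ≡ total Z′ w + ∑[ i < m ] w (ρ i) i
    split w = begin
      total Z w
        ≡⟨ sum-cong-≗ (λ i → trans
             (sum-cong-≗ (λ r → trans (cong (_* w r i) (Z≡ r i)) (*-distribʳ-+ (w r i) (Z′ r i) _)))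
             (∑-distrib-+ (λ r → Z′ r i * w r i) _)) ⟩
      ∑[ i < m ] (∑[ r < m ] (Z′ r i * w r i) + ∑[ r < m ] (eq (ρ i) r * w r i))
        ≡⟨ ∑-distrib-+ (λ i → ∑[ r < m ] (Z′ r i * w r i)) _ ⟩
      total Z′ w + ∑[ i < m ] (∑[ r < m ] (eq (ρ i) r * w r i))
        ≡⟨ cong (total Z′ w +_) (sum-cong-≗ (λ i → sum-eq (ρ i) (λ r → w r i))) ⟩
      total Z′ w + ∑[ i < m ] w (ρ i) i ∎

    rows′ : ∀ i → ∑[ r < m ] Z′ r i ≡ k
    rows′ i = +-cancelʳ-≡ 1 _ _ (begin
      sum (λ r → Z′ r i) + 1                ≡⟨ cong (sum (λ r → Z′ r i) +_) (sym (sum-eq-1 (ρ i))) ⟩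
      sum (λ r → Z′ r i) + sum (eq (ρ i))   ≡⟨ sym (∑-distrib-+ (λ r → Z′ r i) _) ⟩
      sum (λ r → Z′ r i + eq (ρ i) r)       ≡⟨ sum-cong-≗ (λ r → sym (Z≡ r i)) ⟩
      sum (λ r → Z r i)                     ≡⟨ rows i ⟩
      suc k                                 ≡⟨ +-comm 1 k ⟩
      k + 1                                 ∎)

    cols′ : ∀ j → total Z′ (λ r i → eq (σ r i) j) ≡ k
    cols′ j = +-cancelʳ-≡ 1 _ _ (begin
      total Z′ w + 1                            ≡⟨ cong (total Z′ w +_) (sym (fibre≡1 (λ i → σ (ρ i) i) inj j)) ⟩
      total Z′ w + ∑[ i < m ] w (ρ i) i         ≡⟨ sym (split w) ⟩
      total Z w                                 ≡⟨ cols j ⟩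
      suc k                                     ≡⟨ +-comm 1 k ⟩
      k + 1                                     ∎)
      where
      w : Fin m → Fin m → ℕ
      w r i = eq (σ r i) j

  -- Forgetting which matching an edge comes from leaves a regular bipartite multigraph `X`. Hall's
  -- theorem gives a matching `τ` in it, and each edge of `τ` is traced back to some `r`.
  regular⇒transversal : ∀ {k} Z → Regular (suc k) Z →
    ¬ ¬ (Σ (Fin m → Fin m) λ ρ → (∀ i → Z (ρ i) i ≢ 0) × Transversal ρ)
  regular⇒transversal {k} Z (rows , cols) ¬tr =
    Hall-matching (Hall-regular k X rowsX colsX) λ (τ , inj , Xτ) →
      let edge : ∀ i → Σ (Fin m) λ r → Z r i * eq (σ r i) (τ i) ≢ 0
          edge i = sum-≢0 (λ r → Z r i * eq (σ r i) (τ i)) (λ e → Xτ i (λ ne → ne e))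
          ρ : Fin m → Fin m
          ρ i = proj₁ (edge i)
          σρ : ∀ i → σ (ρ i) i ≡ τ i
          σρ i = on-edge (Z (ρ i) i) (proj₂ (edge i))
      in ¬tr (ρ , (λ i Z≡0 → proj₂ (edge i) (cong (_* eq (σ (ρ i) i) (τ i)) Z≡0)) ,
              λ {x} {y} e → inj (trans (sym (σρ x)) (trans e (σρ y))))
    where
    X : Fin m → Fin m → ℕ
    X i j = ∑[ r < m ] (Z r i * eq (σ r i) j)

    on-edge : ∀ z {x y : Fin m} → z * eq x y ≢ 0 → x ≡ y
    on-edge z {x} {y} ne with x ≟ y
    ... | yes x≡y = x≡y
    ... | no _ = ⊥-elim (ne (*-zeroʳ z))

    rowsX : ∀ i → ∑[ j < m ] X i j ≡ suc k
    rowsX i = trans (∑-comm (λ j r → Z r i * eq (σ r i) j)) (trans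
      (sum-cong-≗ (λ r → trans (sym (*-distribˡ-sum (Z r i) (eq (σ r i))))
        (trans (cong (Z r i *_) (sum-eq-1 (σ r i))) (*-identityʳ _))))
      (rows i))

    colsX : ∀ j → ∑[ i < m ] X i j ≡ suc k
    colsX = cols

  rearrange : ∀ a b c d → (a + b) + (c + d) ≡ (c + a) + (b + d)
  rearrange = solve-∀

  module _ (p q : Fin m → Fin m → ℕ) (δ : ℕ)
    (valid : ∀ ρ → Transversal ρ → ∑[ i < m ] p (ρ i) i ≤ δ + ∑[ i < m ] q (ρ i) i) where

    -- Induction peels off one transversal at a time. The inequality is decidable, so a transversal
    -- known up to double negation suffices.
    regular-valid : ∀ k Z → Regular k Z → total Z p ≤ k * δ + total Z q
    regular-valid zero Z (rows , _) = ≤-trans (≤-reflexive (sum-zero λ i → sum-zero λ r →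
      cong (_* p r i) (n≤0⇒n≡0 (≤-trans (term≤sum (λ r → Z r i) r) (≤-reflexive (rows i)))))) z≤n
    regular-valid (suc k) Z reg = decidable-stable (_ ≤? _) λ ¬≤ →
      regular⇒transversal Z reg λ (ρ , Zρ , tr) →
      let Z′ , reg′ , split = peel Z reg ρ Zρ tr
          open ≤-Reasoning
      in ¬≤ (begin
        total Z p                                      ≡⟨ split p ⟩
        total Z′ p + ∑[ i < m ] p (ρ i) i              ≤⟨ +-mono-≤ (regular-valid k Z′ reg′) (valid ρ tr) ⟩
        (k * δ + total Z′ q) + (δ + ∑[ i < m ] q (ρ i) i)  ≡⟨ rearrange (k * δ) (total Z′ q) δ _ ⟩
        (δ + k * δ) + (total Z′ q + ∑[ i < m ] q (ρ i) i)  ≡⟨ cong (suc k * δ +_) (sym (split q)) ⟩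
        suc k * δ + total Z q                          ∎)

    -- The diagonal edges (i , i) form a matching; if every matching r is tight, the
    -- (m - 1)-regular remainder decomposes into valid matchings, so the diagonal is tight too.
    exchange : m ≢ 0 → (∀ r → Injective _≡_ _≡_ (σ r)) → Transversal (λ i → i) →
      (∀ r → δ + ∑[ i < m ] q r i ≤ ∑[ i < m ] p r i) →
      δ + ∑[ i < m ] q i i ≤ ∑[ i < m ] p i i
    exchange m≢0 σ-inj diag tight = +-cancelˡ-≤ (k * δ + total Z′ q) _ _ (begin
      (k * δ + total Z′ q) + (δ + ∑[ i < m ] q i i)    ≡⟨ rearrange (k * δ) (total Z′ q) δ _ ⟩
      suc k * δ + (total Z′ q + ∑[ i < m ] q i i)      ≡⟨ cong₂ _+_ (cong (_* δ) 1+k≡m) (trans (sym (split q)) (total-ones q)) ⟩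
      m * δ + ∑[ r < m ] (∑[ i < m ] q r i)            ≡⟨ cong (_+ ∑[ r < m ] (∑[ i < m ] q r i)) (sym (sum-const m δ)) ⟩
      ∑[ r < m ] δ + ∑[ r < m ] (∑[ i < m ] q r i)     ≡⟨ sym (∑-distrib-+ {m} (λ _ → δ) _) ⟩
      ∑[ r < m ] (δ + ∑[ i < m ] q r i)                ≤⟨ sum-mono tight ⟩
      ∑[ r < m ] (∑[ i < m ] p r i)                    ≡⟨ sym (total-ones p) ⟩
      total ones p                                     ≡⟨ split p ⟩
      total Z′ p + ∑[ i < m ] p i i                    ≤⟨ +-monoˡ-≤ _ (regular-valid k Z′ reg′) ⟩
      (k * δ + total Z′ q) + ∑[ i < m ] p i i          ∎)
      where
      open ≤-Reasoning
      k : ℕ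
      k = m ∸ 1
      1+k≡m : suc k ≡ m
      1+k≡m = m+[n∸m]≡n (n≢0⇒n>0 m≢0)
      -- The union of all m matchings, an m-regular multigraph.
      ones : Fin m → Fin m → ℕ
      ones _ _ = 1
      total-ones : ∀ w → total ones w ≡ ∑[ r < m ] (∑[ i < m ] w r i)
      total-ones w = trans (sum-cong-≗ (λ i → sum-cong-≗ (λ r → +-identityʳ (w r i))))
        (∑-comm (λ i r → w r i))
      reg : Regular (suc k) ones
      reg = (λ i → trans (sum-const m 1) (trans (*-identityʳ m) (sym 1+k≡m))) ,
            (λ j → trans (total-ones _) (trans (sum-cong-≗ (λ r → fibre≡1 (σ r) (σ-inj r) j))
              (trans (sum-const m 1) (trans (*-identityʳ m) (sym 1+k≡m)))))
      peeled = peel ones reg (λ i → i) (λ _ ()) diag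
      Z′ = proj₁ peeled
      reg′ = proj₁ (proj₂ peeled)
      split = proj₂ (proj₂ peeled)

-- Rectangle covers of unique disjointness

inter : ∀ {n} → Vec Bool n → Vec Bool n → ℕ
inter {n} a b = ∑[ i < n ] 𝟙 (lookup a i ∧ lookup b i)

-- The sum of f over all pairs of disjoint sets.
disjSum : ∀ n → (Vec Bool n → Vec Bool n → ℕ) → ℕ
disjSum zero    f = f [] []
disjSum (suc n) f = disjSum n λ a b →
  f (false ∷ a) (false ∷ b) + f (true ∷ a) (false ∷ b) + f (false ∷ a) (true ∷ b)

disjSum-mono : ∀ n {f g : Vec Bool n → Vec Bool n → ℕ} →
  (∀ a b → inter a b ≡ 0 → f a b ≤ g a b) → disjSum n f ≤ disjSum n g
disjSum-mono zero    f≤g = f≤g [] [] refl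
disjSum-mono (suc n) f≤g = disjSum-mono n λ a b ab →
  +-mono-≤ (+-mono-≤ (f≤g (false ∷ a) (false ∷ b) ab) (f≤g (true ∷ a) (false ∷ b) ab))
           (f≤g (false ∷ a) (true ∷ b) ab)

disjSum-+ : ∀ n (f g : Vec Bool n → Vec Bool n → ℕ) →
  disjSum n (λ a b → f a b + g a b) ≤ disjSum n f + disjSum n g
disjSum-+ zero    f g = ≤-refl
disjSum-+ (suc n) f g = ≤-trans
  (disjSum-mono n λ a b _ → ≤-reflexive (rearrange (f (false ∷ a) (false ∷ b)) (g (false ∷ a) (false ∷ b))
     (f (true ∷ a) (false ∷ b)) (g (true ∷ a) (false ∷ b)) (f (false ∷ a) (true ∷ b)) (g (false ∷ a) (true ∷ b))))
  (disjSum-+ n _ _)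
  where
  rearrange : ∀ a b c d e h → a + b + (c + d) + (e + h) ≡ (a + c + e) + (b + d + h)
  rearrange = solve-∀

disjSum-const : ∀ n c → disjSum n (λ _ _ → c) ≡ 3 ^ n * c
disjSum-const zero    c = sym (+-identityʳ c)
disjSum-const (suc n) c = trans (disjSum-const n (c + c + c)) (arith (3 ^ n) c)
  where
  arith : ∀ x c → x * (c + c + c) ≡ (x + (x + (x + 0))) * c
  arith = solve-∀

disjSum-∑ : ∀ n k (f : Fin k → Vec Bool n → Vec Bool n → ℕ) {c} → (∀ i → disjSum n (f i) ≤ c) →
  disjSum n (λ a b → ∑[ i < k ] f i a b) ≤ k * c
disjSum-∑ n zero    f f≤c = ≤-reflexive (trans (disjSum-const n 0) (*-zeroʳ (3 ^ n)))
disjSum-∑ n (suc k) f f≤c = ≤-trans (disjSum-+ n (f zero) _)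
  (+-mono-≤ (f≤c zero) (disjSum-∑ n k (f ∘ suc) (f≤c ∘ suc)))

-- Kaibel and Weltge: at most two of the three extensions of a disjoint pair lie in the
-- rectangle, and they are distributed over two rectangles of one dimension less.
rectangle-bound : ∀ n (𝒜 ℬ : Vec Bool n → Bool) →
  (∀ a b → 𝒜 a ≡ true → ℬ b ≡ true → inter a b ≢ 1) →
  disjSum n (λ a b → 𝟙 (𝒜 a) * 𝟙 (ℬ b)) ≤ 2 ^ n
rectangle-bound zero 𝒜 ℬ uniq with 𝒜 [] | ℬ []
... | true  | true  = ≤-refl
... | true  | false = z≤n
... | false | _     = z≤n
rectangle-bound (suc n) 𝒜 ℬ uniq = begin
  disjSum n (λ a b → 𝟙 (𝒜₀ a) * 𝟙 (ℬ₀ b) + 𝟙 (𝒜₁ a) * 𝟙 (ℬ₀ b) + 𝟙 (𝒜₀ a) * 𝟙 (ℬ₁ b))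
    ≤⟨ disjSum-mono n (λ a b ab → split (𝒜₀ a) (𝒜₁ a) (ℬ₀ b) (ℬ₁ b)
         (λ a∈ b∈ → uniq (true ∷ a) (true ∷ b) a∈ b∈ (cong suc ab))) ⟩
  disjSum n (λ a b → 𝟙 (𝒜₀ a ∨ 𝒜₁ a) * 𝟙 (ℬ₀ b) + 𝟙 (𝒜₀ a) * 𝟙 (ℬ₀ b ∨ ℬ₁ b))
    ≤⟨ disjSum-+ n (λ a b → 𝟙 (𝒜₀ a ∨ 𝒜₁ a) * 𝟙 (ℬ₀ b)) _ ⟩
  disjSum n (λ a b → 𝟙 (𝒜₀ a ∨ 𝒜₁ a) * 𝟙 (ℬ₀ b)) + disjSum n (λ a b → 𝟙 (𝒜₀ a) * 𝟙 (ℬ₀ b ∨ ℬ₁ b))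
    ≤⟨ +-mono-≤ (rectangle-bound n _ _ uniqˡ) (rectangle-bound n _ _ uniqʳ) ⟩
  2 ^ n + 2 ^ n
    ≡⟨ cong (2 ^ n +_) (sym (+-identityʳ _)) ⟩
  2 ^ suc n ∎
  where
  open ≤-Reasoning
  𝒜₀ 𝒜₁ ℬ₀ ℬ₁ : Vec Bool n → Bool
  𝒜₀ a = 𝒜 (false ∷ a)
  𝒜₁ a = 𝒜 (true ∷ a)
  ℬ₀ b = ℬ (false ∷ b)
  ℬ₁ b = ℬ (true ∷ b)

  -- The extensions of `a` and `b` by true would meet in exactly one element, so `x₁` and `y₁` are
  -- not both true.
  split : ∀ x₀ x₁ y₀ y₁ → (x₁ ≡ true → y₁ ≡ true → ⊥) →
    𝟙 x₀ * 𝟙 y₀ + 𝟙 x₁ * 𝟙 y₀ + 𝟙 x₀ * 𝟙 y₁ ≤ 𝟙 (x₀ ∨ x₁) * 𝟙 y₀ + 𝟙 x₀ * 𝟙 (y₀ ∨ y₁)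
  split _     true  _     true  ¬both = ⊥-elim (¬both refl refl)
  split false true  false false _ = z≤n
  split false true  true  false _ = ≤-refl
  split true  true  false false _ = z≤n
  split true  true  true  false _ = ≤-refl
  split false false false y₁ _ = z≤n
  split false false true  y₁ _ = z≤n
  split true  false false y₁ _ = ≤-refl
  split true  false true  false _ = s≤s z≤n
  split true  false true  true  _ = ≤-refl

  uniqˡ : ∀ a b → 𝒜₀ a ∨ 𝒜₁ a ≡ true → ℬ₀ b ≡ true → inter a b ≢ 1
  uniqˡ a b a∈ b∈ with 𝒜₀ a in eq₀
  ... | true  = uniq (false ∷ a) (false ∷ b) eq₀ b∈
  ... | false = uniq (true ∷ a) (false ∷ b) a∈ b∈

  uniqʳ : ∀ a b → 𝒜₀ a ≡ true → ℬ₀ b ∨ ℬ₁ b ≡ true → inter a b ≢ 1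
  uniqʳ a b a∈ b∈ with ℬ₀ b in eq₀
  ... | true  = uniq (false ∷ a) (false ∷ b) a∈ eq₀
  ... | false = uniq (false ∷ a) (true ∷ b) a∈ b∈

-- Exponential versus polynomial growth

1+n≤2^n : ∀ n → suc n ≤ 2 ^ n
1+n≤2^n zero    = ≤-refl
1+n≤2^n (suc n) = +-mono-≤ (m^n>0 2 n) (≤-trans (1+n≤2^n n) (m≤m+n _ _))

exponent⇒pow8≤ : ∀ n e → n ≤ 2 ^ e → n ^ 8 * 4 ≤ 2 ^ (e * 8 + 2)
exponent⇒pow8≤ n e n≤ = begin
  n ^ 8 * 4            ≤⟨ *-monoˡ-≤ 4 (^-monoˡ-≤ 8 n≤) ⟩
  (2 ^ e) ^ 8 * 2 ^ 2  ≡⟨ cong (_* 2 ^ 2) (^-*-assoc 2 e 8) ⟩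
  2 ^ (e * 8) * 2 ^ 2  ≡⟨ sym (^-distribˡ-+-* 2 (e * 8) 2) ⟩
  2 ^ (e * 8 + 2)      ∎
  where open ≤-Reasoning

-- With s = n / 16, n + 1 ≤ 16 (s + 1) ≤ 2 ^ (s + 4), so the left side is at most 2 ^ (8s + 34). The
-- bound 80 = 5 * 16 gives s ≥ 5, whence 8s + 34 ≤ 16s ≤ n.
[1+n]^8≤ : ∀ n → 80 ≤ n → suc n ^ 8 * 4 ≤ 2 ^ n
[1+n]^8≤ n 80≤n =
  ≤-trans (exponent⇒pow8≤ (suc n) (s + 4) 1+n≤) (^-monoʳ-≤ 2 exponent)
  where
  open ≤-Reasoning
  s = n / 16
  n≡ : n ≡ n % 16 + s * 16
  n≡ = m≡m%n+[m/n]*n n 16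

  5≤s : 5 ≤ s
  5≤s = ≤-pred (*-cancelʳ-< 16 5 (suc s) (begin-strict
    80                ≤⟨ 80≤n ⟩
    n                 ≡⟨ n≡ ⟩
    n % 16 + s * 16   <⟨ +-monoˡ-< (s * 16) (m%n<n n 16) ⟩
    suc s * 16        ∎))

  exponent : (s + 4) * 8 + 2 ≤ n
  exponent = begin
    (s + 4) * 8 + 2   ≡⟨ arith₁ s ⟩
    34 + s * 8        ≤⟨ +-monoˡ-≤ (s * 8) (≤-trans (toWitness {a? = 34 ≤? 40} _) (*-monoˡ-≤ 8 5≤s)) ⟩
    s * 8 + s * 8     ≡⟨ arith₂ s ⟩
    s * 16            ≤⟨ m≤n+m (s * 16) (n % 16) ⟩
    n % 16 + s * 16   ≡⟨ sym n≡ ⟩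
    n                 ∎
    where
    arith₁ : ∀ s → (s + 4) * 8 + 2 ≡ 34 + s * 8
    arith₁ = solve-∀
    arith₂ : ∀ s → s * 8 + s * 8 ≡ s * 16
    arith₂ = solve-∀

  1+n≤ : suc n ≤ 2 ^ (s + 4)
  1+n≤ = begin
    suc n                  ≡⟨ cong suc n≡ ⟩
    suc (n % 16) + s * 16  ≤⟨ +-monoˡ-≤ (s * 16) (m%n<n n 16) ⟩
    suc s * 16             ≤⟨ *-monoˡ-≤ 16 (1+n≤2^n s) ⟩
    2 ^ s * 2 ^ 4          ≡⟨ sym (^-distribˡ-+-* 2 s 4) ⟩
    2 ^ (s + 4)            ∎

^-distribʳ-* : ∀ k a b → (a * b) ^ k ≡ a ^ k * b ^ k
^-distribʳ-* zero    a b = refl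
^-distribʳ-* (suc k) a b = trans (cong (a * b *_) (^-distribʳ-* k a b)) (arith a b (a ^ k) (b ^ k))
  where
  arith : ∀ a b c d → a * b * (c * d) ≡ a * c * (b * d)
  arith = solve-∀

-- Since 3⁴ ≥ 2⁶, a fourth power trades x = 3ⁿ against y = 2ⁿ with a gain of y².
fourth-power : ∀ x y m C → .{{NonZero y}} → y ^ 6 ≤ x ^ 4 → x ≤ m * (m * (C * y)) →
  y * y ≤ m ^ 8 * C ^ 4
fourth-power x y m C y⁶≤x⁴ x≤ = *-cancelʳ-≤ _ _ (y ^ 4) {{m^n≢0 y 4}} (begin
  y * y * y ^ 4              ≡⟨ *-assoc y y (y ^ 4) ⟩
  y ^ 6                      ≤⟨ y⁶≤x⁴ ⟩
  x ^ 4                      ≤⟨ ^-monoˡ-≤ 4 x≤ ⟩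
  (m * (m * (C * y))) ^ 4    ≡⟨ cong (_^ 4) (arith m C y) ⟩
  (m ^ 2 * C * y) ^ 4        ≡⟨ ^-distribʳ-* 4 (m ^ 2 * C) y ⟩
  (m ^ 2 * C) ^ 4 * y ^ 4    ≡⟨ cong (_* y ^ 4) (^-distribʳ-* 4 (m ^ 2) C) ⟩
  (m ^ 2) ^ 4 * C ^ 4 * y ^ 4  ≡⟨ cong (λ z → z * C ^ 4 * y ^ 4) (^-*-assoc m 2 4) ⟩
  m ^ 8 * C ^ 4 * y ^ 4      ∎)
  where
  open ≤-Reasoning
  arith : ∀ m C y → m * (m * (C * y)) ≡ m * (m * 1) * C * y
  arith = solve-∀

-- The gain y² = 4 ^ n from `fourth-power` pays for both the factor 2 ^ (n + 1) and the polynomial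
-- factor C ^ 4 ≤ N ^ 8.
cover⇒exponential : ∀ n m → 80 ≤ suc n →
  3 ^ n ≤ m * (m * (suc (suc n) * (suc n * 2 ^ n))) → 2 ^ suc n ≤ m ^ 8
cover⇒exponential n m 80≤n cover = *-cancelʳ-≤ _ _ (C ^ 4) {{m^n≢0 C 4}} (begin
  2 ^ suc n * C ^ 4        ≤⟨ *-monoʳ-≤ (2 ^ suc n) C⁴≤ ⟩
  2 ^ suc n * N ^ 8        ≤⟨ *-cancelʳ-≤ _ _ 4 four ⟩
  y * y                    ≤⟨ fourth-power (3 ^ n) y m C {{m^n≢0 2 n}} y⁶≤ cover′ ⟩
  m ^ 8 * C ^ 4            ∎)
  where
  open ≤-Reasoning
  N = suc (suc n)
  C = N * suc n
  y = 2 ^ n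

  pow-swap : ∀ b k → (b ^ n) ^ k ≡ (b ^ k) ^ n
  pow-swap b k = trans (^-*-assoc b n k) (trans (cong (b ^_) (*-comm n k)) (sym (^-*-assoc b k n)))

  y⁶≤ : y ^ 6 ≤ (3 ^ n) ^ 4
  y⁶≤ = subst₂ _≤_ (sym (pow-swap 2 6)) (sym (pow-swap 3 4)) (^-monoˡ-≤ n (toWitness {a? = 2 ^ 6 ≤? 3 ^ 4} _))

  cover′ : 3 ^ n ≤ m * (m * (C * y))
  cover′ = ≤-trans cover (≤-reflexive (cong (λ z → m * (m * z)) (sym (*-assoc N (suc n) y))))

  C⁴≤ : C ^ 4 ≤ N ^ 8
  C⁴≤ = ≤-trans (^-monoˡ-≤ 4 (*-monoʳ-≤ N (≤-trans (n≤1+n (suc n)) (≤-reflexive (sym (*-identityʳ N))))))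
    (≤-reflexive (^-*-assoc N 2 4))

  four : 2 ^ suc n * N ^ 8 * 4 ≤ y * y * 4
  four = begin
    2 ^ suc n * N ^ 8 * 4    ≡⟨ *-assoc (2 ^ suc n) (N ^ 8) 4 ⟩
    2 ^ suc n * (N ^ 8 * 4)  ≤⟨ *-monoʳ-≤ (2 ^ suc n) ([1+n]^8≤ (suc n) 80≤n) ⟩
    2 ^ suc n * 2 ^ suc n    ≡⟨ arith y ⟩
    y * y * 4                ∎
    where
    arith : ∀ y → (y + (y + 0)) * (y + (y + 0)) ≡ y * y * 4
    arith = solve-∀

-- For t = 2s, 2 ^ t ≥ (s + 1)², and s is chosen large enough for this square to exceed the linear
-- function.
linear<exponential : ∀ α β N → Σ ℕ λ t → N ≤ t × α * t + β < 2 ^ t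
linear<exponential α β N = s + s , ≤-trans (m≤n+m N (α + α + β)) (m≤m+n s s) , (begin-strict
  α * (s + s) + β              ≤⟨ +-monoʳ-≤ (α * (s + s)) (≤-trans (m≤n+m β (α + α)) (m≤m+n _ N)) ⟩
  α * (s + s) + s              ≤⟨ m≤m+n _ _ ⟩
  α * (s + s) + s + ((β + N) * s + s)  ≡⟨ arith α (β) N s ⟩
  (α + α + β + N) * s + s + s  <⟨ n<1+n _ ⟩
  suc (s * s + s + s)          ≡⟨ arith₂ s ⟩
  suc s * suc s                ≤⟨ *-mono-≤ (1+n≤2^n s) (1+n≤2^n s) ⟩
  2 ^ s * 2 ^ s                ≡⟨ sym (^-distribˡ-+-* 2 s s) ⟩
  2 ^ (s + s)                  ∎)
  where
  open ≤-Reasoning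
  s = α + α + β + N
  arith : ∀ α β N s → α * (s + s) + s + ((β + N) * s + s) ≡ (α + α + β + N) * s + s + s
  arith = solve-∀
  arith₂ : ∀ s → suc (s * s + s + s) ≡ suc s * suc s
  arith₂ = solve-∀

-- At n = 2 ^ t the polynomial is bounded by a power of 2 whose exponent is linear in `t`, to be
-- compared with 2 ^ t.
polynomial<exponential : ∀ c k N → Σ ℕ λ n → N ≤ n × (c * n ^ k + c) ^ 8 < 2 ^ n
polynomial<exponential c k N =
  let t , N≤t , lin = linear<exponential (k * 8) (suc c * 8) N
      n = 2 ^ t
      open ≤-Reasoning
      c≤2^c : c ≤ 2 ^ c
      c≤2^c = ≤-trans (n≤1+n c) (1+n≤2^n c)
  in n , ≤-trans N≤t (≤-trans (n≤1+n t) (1+n≤2^n t)) , (begin-strict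
  (c * n ^ k + c) ^ 8                  ≤⟨ ^-monoˡ-≤ 8 (+-mono-≤ (*-monoˡ-≤ (n ^ k) c≤2^c)
                                            (≤-trans c≤2^c (m≤m*n (2 ^ c) (n ^ k) {{m^n≢0 n k {{m^n≢0 2 t}}}}))) ⟩
  (2 ^ c * n ^ k + 2 ^ c * n ^ k) ^ 8  ≡⟨ cong (_^ 8) (arith₁ (2 ^ c) (n ^ k)) ⟩
  (2 ^ suc c * n ^ k) ^ 8              ≡⟨ cong (λ z → (2 ^ suc c * z) ^ 8) (^-*-assoc 2 t k) ⟩
  (2 ^ suc c * 2 ^ (t * k)) ^ 8        ≡⟨ cong (_^ 8) (sym (^-distribˡ-+-* 2 (suc c) (t * k))) ⟩
  (2 ^ (suc c + t * k)) ^ 8            ≡⟨ ^-*-assoc 2 (suc c + t * k) 8 ⟩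
  2 ^ ((suc c + t * k) * 8)            ≡⟨ cong (2 ^_) (arith₂ c t k) ⟩
  2 ^ (k * 8 * t + suc c * 8)          <⟨ ^-monoʳ-< 2 (s≤s (s≤s z≤n)) lin ⟩
  2 ^ n                                ∎)
  where
  arith₁ : ∀ x y → x * y + x * y ≡ (x + (x + 0)) * y
  arith₁ = solve-∀
  arith₂ : ∀ c t k → (suc c + t * k) * 8 ≡ k * 8 * t + suc c * 8
  arith₂ = solve-∀

-- Linear functionals on exponents

Weights : ℕ → Set
Weights n = Fin n → Fin n → ℕ

weigh : ∀ {n} → Weights n → (Fin n × Fin n → ℕ) → ℕ
weigh {n} u μ = ∑[ i < n ] (∑[ j < n ] (u i j * μ (i , j)))

-- Exponents are known only off the diagonal, so the weights have to vanish on it.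
weigh-cong : ∀ {n} (u : Weights n) → (∀ i → u i i ≡ 0) → ∀ {μ ν : Fin n × Fin n → ℕ} →
  (∀ v → v ∈ offDiag n → μ v ≡ ν v) → weigh u μ ≡ weigh u ν
weigh-cong {n} u diag {μ} {ν} μ≐ν = sum-cong-≗ λ i → sum-cong-≗ λ j → cell i j
  where
  cell : ∀ i j → u i j * μ (i , j) ≡ u i j * ν (i , j)
  cell i j with i ≟ j
  ... | no i≢j = cong (u i j *_) (μ≐ν (i , j) (offDiag-complete i≢j))
  ... | yes refl rewrite diag i = refl

weigh-∑ : ∀ {n k} (u : Weights n) (s : Fin k → Fin n × Fin n → ℕ) →
  weigh u (λ v → ∑[ t < k ] s t v) ≡ ∑[ t < k ] weigh u (s t)
weigh-∑ {n} {k} u s = begin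
  ∑[ i < n ] (∑[ j < n ] (u i j * ∑[ t < k ] s t (i , j)))
    ≡⟨ sum-cong-≗ (λ i → sum-cong-≗ (λ j → *-distribˡ-sum (u i j) (λ t → s t (i , j)))) ⟩
  ∑[ i < n ] (∑[ j < n ] (∑[ t < k ] (u i j * s t (i , j))))
    ≡⟨ sum-cong-≗ (λ i → ∑-comm (λ j t → u i j * s t (i , j))) ⟩
  ∑[ i < n ] (∑[ t < k ] (∑[ j < n ] (u i j * s t (i , j))))
    ≡⟨ ∑-comm (λ i t → ∑[ j < n ] (u i j * s t (i , j))) ⟩
  ∑[ t < k ] weigh u (s t) ∎
  where open ≡-Reasoning

-- Facets of the cut polytope

-- The set b ⊆ {1, …, n} gives a valid inequality for cuts on {0, …, n}.  If k elements of b
-- are separated from 0 then, up to the factor δ = q - 1, it reads 0 ≤ (1 - k)², that is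
-- 2k + k(|b| - k) ≤ 1 + |b|k: here 2k + k(|b| - k) is the `lower` weight of the cut
-- and |b|k is its `upper` weight.
∣_∣ᵇ : ∀ {n} → Vec Bool n → ℕ
∣_∣ᵇ {n} b = ∑[ i < n ] 𝟙 (lookup b i)

lower upper : ∀ {n} → Vec Bool n → Weights (suc n)
lower b zero    zero    = 0
lower b zero    (suc j) = 2 * 𝟙 (lookup b j)
lower b (suc i) zero    = 2 * 𝟙 (lookup b i)
lower b (suc i) (suc j) = (1 ∸ eq i j) * (𝟙 (lookup b i) * 𝟙 (lookup b j))
upper b zero    zero    = 0
upper b zero    (suc j) = ∣ b ∣ᵇ * 𝟙 (lookup b j)
upper b (suc i) zero    = ∣ b ∣ᵇ * 𝟙 (lookup b i)
upper b (suc i) (suc j) = 0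

lower-diag : ∀ {n} (b : Vec Bool n) i → lower b i i ≡ 0
lower-diag b zero    = refl
lower-diag b (suc i) rewrite eq-refl i = refl

upper-diag : ∀ {n} (b : Vec Bool n) i → upper b i i ≡ 0
upper-diag b zero    = refl
upper-diag b (suc i) = refl

-- The bit `z` tells whether vertex 0 lies in the cut. The number of elements of `b` separated from
-- 0 is `p` when `z` is false and `r` when it is true.
module CutWeights {n : ℕ} (q : ℕ) (a b : Vec Bool n) where
  δ p r : ℕ
  δ = q ∸ 1
  p = inter a b
  r = ∑[ i < n ] 𝟙 (not (lookup a i) ∧ lookup b i)

  private
    x y : Fin n → ℕ
    x i = 𝟙 (lookup a i ∧ lookup b i)
    y i = 𝟙 (not (lookup a i) ∧ lookup b i)

  cutMon′ : Bool → Fin (suc n) × Fin (suc n) → ℕ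
  cutMon′ z ij = if lookup (z ∷ a) (proj₁ ij) ∧ not (lookup (z ∷ a) (proj₂ ij)) then q ∸ 1 else 0

  ∣b∣≡ : ∣ b ∣ᵇ ≡ p + r
  ∣b∣≡ = trans (sum-cong-≗ cell) (∑-distrib-+ x y)
    where
    cell : ∀ i → 𝟙 (lookup b i) ≡ x i + y i
    cell i with lookup a i | lookup b i
    ... | true  | true  = refl
    ... | true  | false = refl
    ... | false | true  = refl
    ... | false | false = refl

  -- Only pairs leading from `a` ∩ `b` to the rest of `b` contribute, whichever side vertex 0 is on.
  inner : ∀ z i j → lower b (suc i) (suc j) * cutMon′ z (suc i , suc j) ≡ x i * (y j * δ)
  inner z i j with i ≟ j
  inner z i j | yes refl with lookup a i | lookup b i
  ... | true  | true  = refl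
  ... | true  | false = refl
  ... | false | _     = refl
  inner z i j | no _ with lookup a i | lookup b i | lookup a j | lookup b j
  ... | true  | true  | true  | βj    = *-zeroʳ (1 * (1 * 𝟙 βj))
  ... | true  | true  | false | true  = sym (+-identityʳ (δ + 0))
  ... | true  | true  | false | false = refl
  ... | true  | false | _     | _     = refl
  ... | false | βi    | _     | βj    = *-zeroʳ (1 * (𝟙 βi * 𝟙 βj))

  inner-sum : ∑[ i < n ] (∑[ j < n ] (x i * (y j * δ))) ≡ p * (r * δ)
  inner-sum = trans
    (sum-cong-≗ λ i → trans (sym (*-distribˡ-sum (x i) (λ j → y j * δ))) (cong (x i *_) (sym (*-distribʳ-sum δ y))))
    (sym (*-distribʳ-sum (r * δ) x))

  out-cell : ∀ c i → c * 𝟙 (lookup b i) * cutMon′ false (suc i , zero) ≡ x i * (c * δ)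
  out-cell c i with lookup a i | lookup b i
  ... | true  | true  rewrite *-identityʳ c | +-identityʳ (c * δ) = refl
  ... | true  | false rewrite *-zeroʳ c = refl
  ... | false | β     = *-zeroʳ (c * 𝟙 β)

  in-cell : ∀ c j → c * 𝟙 (lookup b j) * cutMon′ true (zero , suc j) ≡ y j * (c * δ)
  in-cell c j with lookup a j | lookup b j
  ... | false | true  rewrite *-identityʳ c | +-identityʳ (c * δ) = refl
  ... | false | false rewrite *-zeroʳ c = refl
  ... | true  | β     = *-zeroʳ (c * 𝟙 β)

  zero-row : ∀ (u : Weights (suc n)) → ∑[ j < suc n ] (u zero j * cutMon′ false (zero , j)) ≡ 0
  zero-row u = sum-zero (λ j → *-zeroʳ (u zero j))

  zero-column : ∀ i (u : Weights (suc n)) → u (suc i) zero * cutMon′ true (suc i , zero) ≡ 0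
  zero-column i u with lookup a i
  ... | true  = *-zeroʳ (u (suc i) zero)
  ... | false = *-zeroʳ (u (suc i) zero)

  lower-false : weigh (lower b) (cutMon′ false) ≡ p * (2 * δ) + p * (r * δ)
  lower-false = begin
    weigh (lower b) (cutMon′ false)
      ≡⟨ cong₂ _+_ (zero-row (lower b))
           (trans (sum-cong-≗ (λ i → cong₂ _+_ (out-cell 2 i) (sum-cong-≗ (inner false i))))
             (∑-distrib-+ (λ i → x i * (2 * δ)) (λ i → ∑[ j < n ] (x i * (y j * δ))))) ⟩
    ∑[ i < n ] (x i * (2 * δ)) + ∑[ i < n ] (∑[ j < n ] (x i * (y j * δ)))
      ≡⟨ cong₂ _+_ (sym (*-distribʳ-sum (2 * δ) x)) inner-sum ⟩
    p * (2 * δ) + p * (r * δ) ∎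
    where open ≡-Reasoning

  lower-true : weigh (lower b) (cutMon′ true) ≡ r * (2 * δ) + p * (r * δ)
  lower-true = cong₂ _+_
    (trans (sum-cong-≗ (in-cell 2)) (sym (*-distribʳ-sum (2 * δ) y)))
    (trans (sum-cong-≗ (λ i → cong₂ _+_ (zero-column i (lower b)) (sum-cong-≗ (inner true i)))) inner-sum)

  upper-false : weigh (upper b) (cutMon′ false) ≡ p * ((p + r) * δ)
  upper-false = trans (cong₂ _+_ (zero-row (upper b))
      (sum-cong-≗ (λ i → trans (cong₂ _+_ (out-cell ∣ b ∣ᵇ i) (sum-zero {n} (λ _ → refl))) (+-identityʳ _))))
    (trans (sym (*-distribʳ-sum (∣ b ∣ᵇ * δ) x)) (cong (λ z → p * (z * δ)) ∣b∣≡))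

  upper-true : weigh (upper b) (cutMon′ true) ≡ r * ((p + r) * δ)
  upper-true = trans (cong₂ _+_
      (trans (sum-cong-≗ (in-cell ∣ b ∣ᵇ)) (sym (*-distribʳ-sum (∣ b ∣ᵇ * δ) y)))
      (sum-zero {n} (λ i → cong₂ _+_ (zero-column i (upper b)) (sum-zero {n} (λ _ → refl)))))
    (trans (+-identityʳ _) (cong (λ z → r * (z * δ)) ∣b∣≡))

  2k≤1+k² : ∀ k → 2 * k ≤ 1 + k * k
  2k≤1+k² zero          = z≤n
  2k≤1+k² (suc zero)    = ≤-refl
  2k≤1+k² (suc (suc k)) = ≤-trans (m≤m+n _ (1 + k * k + 2 * k)) (≤-reflexive (arith k))
    where
    arith : ∀ k → 2 * suc (suc k) + (1 + k * k + 2 * k) ≡ 1 + suc (suc k) * suc (suc k)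
    arith = solve-∀

  -- Both weights contain p r δ; what remains is 2k ≤ 1 + k² times δ, with k equal to `p` or `r`.
  facet-valid : ∀ z → weigh (lower b) (cutMon′ z) ≤ δ + weigh (upper b) (cutMon′ z)
  facet-valid false rewrite lower-false | upper-false = begin
    p * (2 * δ) + p * (r * δ)        ≡⟨ arith₁ p r δ ⟩
    2 * p * δ + p * (r * δ)          ≤⟨ +-monoˡ-≤ _ (*-monoˡ-≤ δ (2k≤1+k² p)) ⟩
    (1 + p * p) * δ + p * (r * δ)    ≡⟨ arith₂ p r δ ⟩
    δ + p * ((p + r) * δ)            ∎
    where
    open ≤-Reasoning
    arith₁ : ∀ p r δ → p * (2 * δ) + p * (r * δ) ≡ 2 * p * δ + p * (r * δ)
    arith₁ = solve-∀
    arith₂ : ∀ p r δ → (1 + p * p) * δ + p * (r * δ) ≡ δ + p * ((p + r) * δ)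
    arith₂ = solve-∀
  facet-valid true rewrite lower-true | upper-true = begin
    r * (2 * δ) + p * (r * δ)        ≡⟨ arith₁ p r δ ⟩
    2 * r * δ + p * (r * δ)          ≤⟨ +-monoˡ-≤ _ (*-monoˡ-≤ δ (2k≤1+k² r)) ⟩
    (1 + r * r) * δ + p * (r * δ)    ≡⟨ arith₂ p r δ ⟩
    δ + r * ((p + r) * δ)            ∎
    where
    open ≤-Reasoning
    arith₁ : ∀ p r δ → r * (2 * δ) + p * (r * δ) ≡ 2 * r * δ + p * (r * δ)
    arith₁ = solve-∀
    arith₂ : ∀ p r δ → (1 + r * r) * δ + p * (r * δ) ≡ δ + r * ((p + r) * δ)
    arith₂ = solve-∀

  facet-tight : p ≡ 1 → δ + weigh (upper b) (cutMon′ false) ≡ weigh (lower b) (cutMon′ false)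
  facet-tight p≡1 rewrite lower-false | upper-false | p≡1 = arith r δ
    where
    arith : ∀ r δ → δ + 1 * ((1 + r) * δ) ≡ 1 * (2 * δ) + 1 * (r * δ)
    arith = solve-∀

  facet-disjoint : p ≡ 0 → weigh (lower b) (cutMon′ false) ≡ 0
  facet-disjoint p≡0 rewrite lower-false | p≡0 = refl

-- The rectangle cover

any-set? : ∀ {n p} {P : Vec Bool n → Set p} → (∀ a → Dec (P a)) → Dec (Σ (Vec Bool n) P)
any-set? P? = map′ (λ x → let a , _ , Pa = find x in a , Pa) (λ (a , Pa) → lose (subsets-complete a) Pa)
  (Any.any? P? (subsets _))

module Cover {ℓ : Level} (R : TOSemiring ℓ) {q n m : ℕ} (2≤q : 2 ≤ q)
  (proj : CutPerm.SupportProjection R q (suc (suc n)) m) where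
  open CutPerm R
  open SupportProjection proj

  N : ℕ
  N = suc (suc n)

  -- First component `zero` encodes the constant, with an irrelevant second component; `(suc i , j)`
  -- encodes x_ij. A plain product makes labels easy to sum over.
  Label : Set
  Label = Fin (suc N) × Fin N

  monomial : Label → Fin N × Fin N → ℕ
  monomial (zero  , _) w = 0
  monomial (suc i , j) w = if ⌊ w ≟P (i , j) ⌋ then 1 else 0

  σ : Vec Bool (suc n) → Fin m → Fin m
  σ a = proj₁ (generate (false ∷ a))

  σ-injective : ∀ a → Injective _≡_ _≡_ (σ a)
  σ-injective a = proj₁ (proj₂ (generate (false ∷ a)))

  s : Vec Bool (suc n) → Fin m → Fin N × Fin N → ℕ
  s a = proj₁ (proj₂ (proj₂ (generate (false ∷ a))))

  s∈S : ∀ a i → S (i , σ a i) (s a i)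
  s∈S a = proj₁ (proj₂ (proj₂ (proj₂ (generate (false ∷ a)))))

  ∑s≐ : ∀ a v → v ∈ offDiag N → ∑[ i < m ] s a i v ≡ Objects.cutMon R q N (false ∷ a) v
  ∑s≐ a = proj₂ (proj₂ (proj₂ (proj₂ (generate (false ∷ a)))))

  labelOf : ∀ {w μ} → S w μ → Σ Label λ l → ∀ v → v ∈ offDiag N → monomial l v ≡ μ v
  labelOf Sμ with label Sμ
  ... | inj₁ e             = (zero , zero) , e
  ... | inj₂ ((i , j) , e) = (suc i , j) , e

  Edge : Set
  Edge = Fin m × Label

  _≟E_ : DecidableEquality Edge
  _≟E_ = ≡-dec _≟_ (≡-dec _≟_ _≟_)

  edge : Vec Bool (suc n) → Fin m → Edge
  edge a i = σ a i , proj₁ (labelOf (s∈S a i))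

  -- The label fixes the monomial off the diagonal, where all the weight lies.
  weigh-edge : ∀ u → (∀ i → u i i ≡ 0) → ∀ {a a′ i} → edge a i ≡ edge a′ i → weigh u (s a i) ≡ weigh u (s a′ i)
  weigh-edge u diag {a} {a′} {i} e = trans (sym (of a)) (trans (cong (λ e → weigh u (monomial (proj₂ e))) e) (of a′))
    where
    of : ∀ a → weigh u (monomial (proj₂ (edge a i))) ≡ weigh u (s a i)
    of a = weigh-cong u diag (proj₂ (labelOf (s∈S a i)))

  weigh-matching : ∀ u → (∀ i → u i i ≡ 0) → ∀ a →
    ∑[ i < m ] weigh u (s a i) ≡ weigh u (Objects.cutMon R q N (false ∷ a))
  weigh-matching u diag a = trans (sym (weigh-∑ u (s a))) (weigh-cong u diag (∑s≐ a))

  m≢0 : m ≢ 0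
  -- An empty sum of exponents cannot reach q - 1 ≥ 1 at the variable x_10, for a cut containing 1
  -- but not 0.
  m≢0 refl = m>n⇒m∸n≢0 2≤q (sym (∑s≐ (true ∷ Vec.replicate n false) (suc zero , zero) (offDiag-complete (λ ()))))

  TightThrough : Vec Bool (suc n) → Fin m → Edge → Set
  TightThrough b i e = Σ (Vec Bool (suc n)) λ a → inter a b ≡ 1 × edge a i ≡ e

  tightThrough? : ∀ b i e → Dec (TightThrough b i e)
  tightThrough? b i e = any-set? λ a → (inter a b ℕ.≟ 1) ×-dec (edge a i ≟E e)

  -- Otherwise `exchange` makes the matching of `a` tight for `b`, so δ is at most its lower weight,
  -- which is 0 for disjoint sets; but δ = q - 1 ≥ 1.
  disjoint⇒free-edge : ∀ a b → inter a b ≡ 0 → Σ (Fin m) λ i → ¬ TightThrough b i (edge a i)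
  disjoint⇒free-edge a b ab≡0 with any? (λ i → ¬? (tightThrough? b i (edge a i)))
  ... | yes free = free
  ... | no ¬free = ⊥-elim (m>n⇒m∸n≢0 2≤q (n≤0⇒n≡0 (begin
    δ                                              ≤⟨ m≤m+n δ _ ⟩
    δ + ∑[ i < m ] up i i                          ≤⟨ exchange low up δ valid m≢0 (λ r → σ-injective (a′ r)) diagonal tight ⟩
    ∑[ i < m ] low i i                             ≡⟨ sum-cong-≗ (λ i → weigh-edge (lower b) (lower-diag b) {a′ i} {a} (through i)) ⟩
    ∑[ i < m ] weigh (lower b) (s a i)             ≡⟨ weigh-matching (lower b) (lower-diag b) a ⟩
    weigh (lower b) (Objects.cutMon R q N (false ∷ a))  ≡⟨ CutWeights.facet-disjoint q a b ab≡0 ⟩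
    0                                              ∎)))
    where
    open ≤-Reasoning
    δ : ℕ
    δ = q ∸ 1

    tight-edge : ∀ i → TightThrough b i (edge a i)
    tight-edge i = decidable-stable (tightThrough? b i (edge a i)) (λ ¬t → ¬free (i , ¬t))

    a′ : Fin m → Vec Bool (suc n)
    a′ i = proj₁ (tight-edge i)

    through : ∀ i → edge (a′ i) i ≡ edge a i
    through i = proj₂ (proj₂ (tight-edge i))

    low up : Fin m → Fin m → ℕ
    low r i = weigh (lower b) (s (a′ r) i)
    up r i = weigh (upper b) (s (a′ r) i)

    open Exchange (λ r i → σ (a′ r) i)

    diagonal : Transversal (λ i → i)
    diagonal {i} {j} e = σ-injective a
      (trans (sym (cong proj₁ (through i))) (trans e (cong proj₁ (through j))))

    -- Mixing may produce a cut with vertex 0 on either side, hence the facet inequality for both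
    -- values of `z`.
    valid : ∀ ρ → Transversal ρ → ∑[ i < m ] low (ρ i) i ≤ δ + ∑[ i < m ] up (ρ i) i
    valid ρ inj with closed (λ i → σ (a′ (ρ i)) i) inj (λ i → s (a′ (ρ i)) i) (λ i → s∈S (a′ (ρ i)) i)
    ... | z ∷ A , e = subst₂ (λ x y → x ≤ δ + y)
      (trans (weigh-cong (lower b) (lower-diag b) (λ v v∈ → sym (e v v∈))) (weigh-∑ (lower b) (λ i → s (a′ (ρ i)) i)))
      (trans (weigh-cong (upper b) (upper-diag b) (λ v v∈ → sym (e v v∈))) (weigh-∑ (upper b) (λ i → s (a′ (ρ i)) i)))
      (CutWeights.facet-valid q A b z)

    tight : ∀ r → δ + ∑[ i < m ] up r i ≤ ∑[ i < m ] low r i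
    tight r = ≤-reflexive (trans (cong (δ +_) (weigh-matching (upper b) (upper-diag b) (a′ r)))
      (trans (CutWeights.facet-tight q (a′ r) b (proj₁ (proj₂ (tight-edge r))))
        (sym (weigh-matching (lower b) (lower-diag b) (a′ r)))))

  -- One rectangle per row and labelled edge: the cuts using that edge, against the sets `b` with no
  -- tight cut through it.
  𝒜 ℬ : Fin m → Edge → Vec Bool (suc n) → Bool
  𝒜 i e a = does (edge a i ≟E e)
  ℬ i e b = not (does (tightThrough? b i e))

  rectangle-unique : ∀ i e a b → 𝒜 i e a ≡ true → ℬ i e b ≡ true → inter a b ≢ 1
  rectangle-unique i e a b a∈ b∈ ab≡1 =
    ¬does (tightThrough? b i e) b∈ (a , ab≡1 , from-does (edge a i ≟E e) a∈)
    where
    from-does : ∀ {p} {P : Set p} (P? : Dec P) → does P? ≡ true → P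
    from-does (yes p) _ = p
    ¬does : ∀ {p} {P : Set p} (P? : Dec P) → not (does P?) ≡ true → ¬ P
    ¬does (no ¬p) _ = ¬p

  rectangle : Fin m → Edge → Vec Bool (suc n) → Vec Bool (suc n) → ℕ
  rectangle i e a b = 𝟙 (𝒜 i e a) * 𝟙 (ℬ i e b)

  rectangles₃ : Fin m → Fin m → Fin (suc N) → Vec Bool (suc n) → Vec Bool (suc n) → ℕ
  rectangles₃ i j k a b = ∑[ l < N ] rectangle i (j , k , l) a b

  rectangles₂ : Fin m → Fin m → Vec Bool (suc n) → Vec Bool (suc n) → ℕ
  rectangles₂ i j a b = ∑[ k < suc N ] rectangles₃ i j k a b

  rectangles₁ : Fin m → Vec Bool (suc n) → Vec Bool (suc n) → ℕ
  rectangles₁ i a b = ∑[ j < m ] rectangles₂ i j a b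

  rectangles : Vec Bool (suc n) → Vec Bool (suc n) → ℕ
  rectangles a b = ∑[ i < m ] rectangles₁ i a b

  covered : ∀ a b → inter a b ≡ 0 → 1 ≤ rectangles a b
  covered a b ab≡0 with disjoint⇒free-edge a b ab≡0
  ... | i , ¬t = begin
    1                            ≡⟨ sym in-rectangle ⟩
    rectangle i (edge a i) a b   ≤⟨ term≤sum (λ l → rectangle i (j , k , l) a b) (proj₂ (proj₂ (edge a i))) ⟩
    rectangles₃ i j k a b        ≤⟨ term≤sum (λ k → rectangles₃ i j k a b) k ⟩
    rectangles₂ i j a b          ≤⟨ term≤sum (λ j → rectangles₂ i j a b) j ⟩
    rectangles₁ i a b            ≤⟨ term≤sum (λ i → rectangles₁ i a b) i ⟩
    rectangles a b               ∎
    where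
    open ≤-Reasoning
    j = proj₁ (edge a i)
    k = proj₁ (proj₂ (edge a i))
    in-rectangle : rectangle i (edge a i) a b ≡ 1
    in-rectangle = cong₂ (λ x y → 𝟙 x * 𝟙 (not y))
      (dec-true (edge a i ≟E edge a i) refl) (dec-false (tightThrough? b i (edge a i)) ¬t)

  -- The 3 ^ (n + 1) disjoint pairs are covered by m * m * (N + 1) * N rectangles, each holding at
  -- most 2 ^ (n + 1) of them.
  cover-bound : 3 ^ suc n ≤ m * (m * (suc N * (N * 2 ^ suc n)))
  cover-bound = begin
    3 ^ suc n                            ≡⟨ sym (*-identityʳ _) ⟩
    3 ^ suc n * 1                        ≡⟨ sym (disjSum-const (suc n) 1) ⟩
    disjSum (suc n) (λ _ _ → 1)          ≤⟨ disjSum-mono (suc n) covered ⟩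
    disjSum (suc n) rectangles           ≤⟨ disjSum-∑ (suc n) m rectangles₁ (λ i →
                                            disjSum-∑ (suc n) m (rectangles₂ i) (λ j →
                                            disjSum-∑ (suc n) (suc N) (rectangles₃ i j) (λ k →
                                            disjSum-∑ (suc n) N (λ l → rectangle i (j , k , l)) (λ l →
                                            rectangle-bound (suc n) (𝒜 i (j , k , l)) (ℬ i (j , k , l))
                                              (rectangle-unique i (j , k , l)))))) ⟩
    m * (m * (suc N * (N * 2 ^ suc n)))  ∎
    where open ≤-Reasoning

-- The exponential lower bound and the failure of p-projections

cutProjPerm⇒exponential : ∀ {ℓ} (R : TOSemiring ℓ) {q} → 2 ≤ q → ∀ n m → 80 ≤ n →
  Objects.CutProjPerm R q n m → 2 ^ n ≤ m ^ 8
cutProjPerm⇒exponential R 2≤q (suc zero) m (s≤s ()) proj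
cutProjPerm⇒exponential R 2≤q (suc (suc n)) m 80≤n proj
  -- The axioms allow 1 ≤ 0, as for the natural numbers in reversed order, so both cases occur.
  with IsTotalOrder.total (TOSemiring.isTotalOrder R) (TOSemiring.0# R) (TOSemiring.1# R)
... | inj₁ 0≤1 = cover⇒exponential (suc n) m 80≤n (Cover.cover-bound R 2≤q (CutPerm.supportProjection R 0≤1 proj))
... | inj₂ 1≤0 = ⊥-elim (CutPerm.1≰0 R 2≤q 1≤0 proj)

theorem4p4 : ∀ {ℓ : Level} (R : TOSemiring ℓ) (q : ℕ) → 2 ≤ q →
    (Σ ℕ λ a → Σ ℕ λ b → 0 < a × 0 < b × Σ ℕ λ N →
    ∀ (n m : ℕ) → N ≤ n → Objects.CutProjPerm R q n m → 2 ^ (a * n) ≤ m ^ b)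
    ×
    ¬ (Σ (ℕ → ℕ) λ p → PolyBounded p × Σ ℕ λ N →
    ∀ (n : ℕ) → N ≤ n → Objects.CutProjPerm R q n (p n))
theorem4p4 R q 2≤q =
  -- The fraction 1/8 is the constant ε: 2 ^ n ≤ m ^ 8 says m ≥ 2 ^ (n / 8).
  (1 , 8 , s≤s z≤n , s≤s z≤n , 80 , λ n m 80≤n proj →
    subst (λ e → 2 ^ e ≤ m ^ 8) (sym (*-identityˡ n)) (cutProjPerm⇒exponential R 2≤q n m 80≤n proj)) ,
  λ (p , (c , k , p≤) , N , proj) →
    -- A single n beyond both thresholds at which the eighth power of the polynomial bound is still
    -- below 2 ^ n.
    let n , N⊔80≤n , poly<exp = polynomial<exponential c k (N ⊔ 80)
        2^n≤ = cutProjPerm⇒exponential R 2≤q n (p n) (≤-trans (m≤n⊔m N 80) N⊔80≤n)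
                 (proj n (≤-trans (m≤m⊔n N 80) N⊔80≤n))
    in <⇒≱ poly<exp (≤-trans 2^n≤ (^-monoˡ-≤ 8 (p≤ n)))
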